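{- For all $\Delta\in\{5,6,7,8\}$, for all $\epsilon$ with $0<\epsilon<\Delta-4$, and for all sufficiently large $n>n(\Delta,\epsilon)$, there exists a $\Delta$-regular $n$-vertex graph $G$ with $$\mathsf{sl}(G)>n^{(\Delta-4-\epsilon)/4}.$$
   Context: Graphs are undirected, finite and simple. For a set $P\subseteq\mathbb{R}^2$ of points in the plane and a set $S\subset\mathbb{R}\cup\{\infty\}$ of slopes, $G(P,S)$ is the graph with vertex set $P$ in which two distinct points $v,w\in P$ are adjacent if and only if the slope of the line $\overline{vw}$ is in $S$. The slope parameter $\mathsf{sl}(G)$ of a graph $G$ is the minimum integer $k$ such that $G\cong G(P,S)$ for some point set $P$ and slope set $S$ with $|S|=k$. Here $n(\Delta,\epsilon)$ denotes a threshold depending only on $\Delta$ and $\epsilon$.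
   Formalization: The number of vertices n is restricted to those with Δn even, since for Δ = 5 or 7 and n odd no Δ-regular n-vertex graph exists and the claim as written fails. -}

module Defs where

import Algebra.Properties.CommutativeSemigroup as CommutativeSemigroupProperties
import Algebra.Properties.Group as GroupProperties
open import Algebra.Bundles using (CommutativeMonoid)
open import Data.Fin.Base using (Fin)
open import Data.Fin.Subset using (Subset; _∈_; ∣_∣)
open import Data.Integer.Base using (+_)
open import Data.Maybe.Base using (Maybe; just; nothing)
open import Data.Maybe.Relation.Binary.Pointwise using (Pointwise)
open import Data.Nat.Base as ℕ using (ℕ; suc; _⊔_)
open import Data.Nat.Properties as ℕₚ using (m⊔n≤o⇒m≤o; m⊔n≤o⇒n≤o)
open import Data.Product.Base using (Σ-syntax; ∃-syntax; _×_; _,_; proj₁; proj₂)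
open import Data.Rational.Base as ℚ using (ℚ; 0ℚ; 1ℚ; ½; Positive; positive)
open import Data.Rational.Properties as ℚₚ
open import Function.Bundles using (_⇔_; _↔_; Inverse)
open import Function.Definitions using (Injective)
open import Level using (0ℓ)
open import Relation.Binary.Core using (Rel)
open import Relation.Binary.Definitions using (Symmetric)
open import Relation.Binary.PropositionalEquality
open import Relation.Nullary.Negation using (¬_)

-- ℝ: Cauchy sequences of rationals, with equality _≈ᴿ_ meaning that the
-- difference tends to 0.

infix 4 _≈ᴿ_ _<ᴿ_
infixl 6 _+ᴿ_ _-ᴿ_
infixl 7 _*ᴿ_
infix 8 -ᴿ_

IsCauchy : (ℕ → ℚ) → Set
IsCauchy x = ∀ ε → 0ℚ ℚ.< ε →
  ∃[ N ] (∀ m n → N ℕ.≤ m → N ℕ.≤ n → ℚ.∣ x m ℚ.- x n ∣ ℚ.< ε)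

record ℝ : Set where
  constructor mkℝ
  field
    seq    : ℕ → ℚ
    cauchy : IsCauchy seq

open ℝ public

_≈ᴿ_ : Rel ℝ 0ℓ
x ≈ᴿ y = ∀ ε → 0ℚ ℚ.< ε →
  ∃[ N ] (∀ n → N ℕ.≤ n → ℚ.∣ seq x n ℚ.- seq y n ∣ ℚ.< ε)

_<ᴿ_ : Rel ℝ 0ℓ
x <ᴿ y = ∃[ δ ] (0ℚ ℚ.< δ ×
  ∃[ N ] (∀ n → N ℕ.≤ n → seq x n ℚ.+ δ ℚ.≤ seq y n))

private
  open GroupProperties +-0-group using (⁻¹-involutive)
  open CommutativeSemigroupProperties
    (CommutativeMonoid.commutativeSemigroup +-0-commutativeMonoid) using (interchange)

  half-pos : ∀ {ε} → 0ℚ ℚ.< ε → 0ℚ ℚ.< ½ ℚ.* ε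
  half-pos {ε} 0<ε = positive⁻¹ (½ ℚ.* ε) {{pos*pos⇒pos ½ ε {{positive 0<ε}}}}

  half+half : ∀ ε → ½ ℚ.* ε ℚ.+ ½ ℚ.* ε ≡ ε
  half+half ε = trans (sym (*-distribʳ-+ ε ½ ½)) (*-identityˡ ε)

  neg-involutive : ∀ a → ℚ.- (ℚ.- a) ≡ a
  neg-involutive = ⁻¹-involutive

  +-split : ∀ a b c d → (a ℚ.+ b) ℚ.- (c ℚ.+ d) ≡ (a ℚ.- c) ℚ.+ (b ℚ.- d)
  +-split a b c d = trans (cong (a ℚ.+ b ℚ.+_) (neg-distrib-+ c d))
    (interchange a b (ℚ.- c) (ℚ.- d))

  neg-split : ∀ a b → (ℚ.- a) ℚ.- (ℚ.- b) ≡ ℚ.- (a ℚ.- b)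
  neg-split a b = sym (neg-distrib-+ a (ℚ.- b))

  diff-swap : ∀ a b → a ℚ.- b ≡ ℚ.- (b ℚ.- a)
  diff-swap a b = begin
    a ℚ.- b                    ≡⟨ +-comm a (ℚ.- b) ⟩
    ℚ.- b ℚ.+ a                ≡⟨ cong (ℚ.- b ℚ.+_) (sym (neg-involutive a)) ⟩
    ℚ.- b ℚ.- (ℚ.- a)          ≡⟨ sym (neg-distrib-+ b (ℚ.- a)) ⟩
    ℚ.- (b ℚ.- a)              ∎
    where open ≡-Reasoning

  back : ∀ a b → a ≡ (a ℚ.- b) ℚ.+ b
  back a b = sym (trans (+-assoc a (ℚ.- b) b)
    (trans (cong (a ℚ.+_) (+-inverseˡ b)) (+-identityʳ a)))

  *-diff : ∀ a b c → a ℚ.* (b ℚ.- c) ≡ a ℚ.* b ℚ.- a ℚ.* c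
  *-diff a b c = trans (*-distribˡ-+ a b (ℚ.- c))
    (cong (a ℚ.* b ℚ.+_) (sym (neg-distribʳ-* a c)))

  *-split : ∀ a b c d →
    (a ℚ.* b) ℚ.- (c ℚ.* d) ≡ a ℚ.* (b ℚ.- d) ℚ.+ d ℚ.* (a ℚ.- c)
  *-split a b c d = begin
    a ℚ.* b ℚ.- c ℚ.* d
      ≡⟨ cong (ℚ._- c ℚ.* d) (back (a ℚ.* b) (a ℚ.* d)) ⟩
    (a ℚ.* b ℚ.- a ℚ.* d) ℚ.+ a ℚ.* d ℚ.- c ℚ.* d
      ≡⟨ +-assoc (a ℚ.* b ℚ.- a ℚ.* d) _ _ ⟩
    (a ℚ.* b ℚ.- a ℚ.* d) ℚ.+ (a ℚ.* d ℚ.- c ℚ.* d)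
      ≡⟨ cong₂ ℚ._+_ (sym (*-diff a b d))
           (cong₂ ℚ._-_ (*-comm a d) (*-comm c d)) ⟩
    a ℚ.* (b ℚ.- d) ℚ.+ (d ℚ.* a ℚ.- d ℚ.* c)
      ≡⟨ cong (a ℚ.* (b ℚ.- d) ℚ.+_) (sym (*-diff d a c)) ⟩
    a ℚ.* (b ℚ.- d) ℚ.+ d ℚ.* (a ℚ.- c)
      ∎
    where open ≡-Reasoning

  +-cauchy : ∀ {x y} → IsCauchy x → IsCauchy y → IsCauchy (λ n → x n ℚ.+ y n)
  +-cauchy {x} {y} cx cy ε 0<ε with cx _ (half-pos 0<ε) | cy _ (half-pos 0<ε)
  ... | M , hx | N , hy = M ⊔ N , λ m n p q → begin-strict
    ℚ.∣ (x m ℚ.+ y m) ℚ.- (x n ℚ.+ y n) ∣        ≡⟨ cong ℚ.∣_∣ (+-split (x m) _ _ _) ⟩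
    ℚ.∣ (x m ℚ.- x n) ℚ.+ (y m ℚ.- y n) ∣        ≤⟨ ∣p+q∣≤∣p∣+∣q∣ (x m ℚ.- x n) _ ⟩
    ℚ.∣ x m ℚ.- x n ∣ ℚ.+ ℚ.∣ y m ℚ.- y n ∣
      <⟨ +-mono-< (hx m n (m⊔n≤o⇒m≤o M N p) (m⊔n≤o⇒m≤o M N q))
                  (hy m n (m⊔n≤o⇒n≤o M N p) (m⊔n≤o⇒n≤o M N q)) ⟩
    ½ ℚ.* ε ℚ.+ ½ ℚ.* ε                          ≡⟨ half+half ε ⟩
    ε                                            ∎
    where open ≤-Reasoning

  neg-cauchy : ∀ {x} → IsCauchy x → IsCauchy (λ n → ℚ.- x n)
  neg-cauchy {x} cx ε 0<ε with cx ε 0<ε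
  ... | N , h = N , λ m n p q → subst (ℚ._< ε)
    (sym (trans (cong ℚ.∣_∣ (neg-split (x m) (x n))) (∣-p∣≡∣p∣ (x m ℚ.- x n))))
    (h m n p q)

  eventually-bounded : ∀ {x} → IsCauchy x →
    ∃[ B ] (0ℚ ℚ.< B × ∃[ N ] (∀ n → N ℕ.≤ n → ℚ.∣ x n ∣ ℚ.≤ B))
  eventually-bounded {x} cx with cx 1ℚ (positive⁻¹ 1ℚ)
  ... | N , h = 1ℚ ℚ.+ ℚ.∣ x N ∣
              , +-mono-<-≤ (positive⁻¹ 1ℚ) (0≤∣p∣ (x N))
              , N , λ n p → begin
    ℚ.∣ x n ∣                          ≡⟨ cong ℚ.∣_∣ (back (x n) (x N)) ⟩
    ℚ.∣ (x n ℚ.- x N) ℚ.+ x N ∣        ≤⟨ ∣p+q∣≤∣p∣+∣q∣ (x n ℚ.- x N) _ ⟩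
    ℚ.∣ x n ℚ.- x N ∣ ℚ.+ ℚ.∣ x N ∣    ≤⟨ +-monoˡ-≤ _ (<⇒≤ (h n N p ℕₚ.≤-refl)) ⟩
    1ℚ ℚ.+ ℚ.∣ x N ∣                   ∎
    where open ≤-Reasoning

  scale : ∀ B ε → 0ℚ ℚ.< B → 0ℚ ℚ.< ε → ∃[ δ ] (0ℚ ℚ.< δ × B ℚ.* δ ≡ ε)
  scale B ε 0<B 0<ε = 1/B ℚ.* ε
    , positive⁻¹ _ {{pos*pos⇒pos 1/B {{1/pos⇒pos B}} ε {{positive 0<ε}}}}
    , trans (sym (*-assoc B 1/B ε))
        (trans (cong (ℚ._* ε) (*-inverseʳ B)) (*-identityˡ ε))
    where
    instance
      B-pos : Positive B
      B-pos = positive 0<B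
      B-nonZero : ℚ.NonZero B
      B-nonZero = pos⇒nonZero B
    1/B = ℚ.1/ B

  ∣*∣-< : ∀ {a b B δ} → 0ℚ ℚ.< B → ℚ.∣ a ∣ ℚ.≤ B → ℚ.∣ b ∣ ℚ.< δ →
    ℚ.∣ a ℚ.* b ∣ ℚ.< B ℚ.* δ
  ∣*∣-< {a} {b} {B} {δ} 0<B a≤B b<δ = begin-strict
    ℚ.∣ a ℚ.* b ∣        ≡⟨ ∣p*q∣≡∣p∣*∣q∣ a b ⟩
    ℚ.∣ a ∣ ℚ.* ℚ.∣ b ∣  ≤⟨ *-monoʳ-≤-nonNeg ℚ.∣ b ∣ {{∣-∣-nonNeg b}} a≤B ⟩
    B ℚ.* ℚ.∣ b ∣        <⟨ *-monoʳ-<-pos B {{positive 0<B}} b<δ ⟩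
    B ℚ.* δ              ∎
    where open ≤-Reasoning

  *-cauchy : ∀ {x y} → IsCauchy x → IsCauchy y → IsCauchy (λ n → x n ℚ.* y n)
  *-cauchy {x} {y} cx cy ε 0<ε
    with eventually-bounded {x} cx | eventually-bounded {y} cy
  ... | B , 0<B , K , bx | C , 0<C , L , by
    with scale B _ 0<B (half-pos 0<ε) | scale C _ 0<C (half-pos 0<ε)
  ... | δ , 0<δ , Bδ | η , 0<η , Cη
    with cy δ 0<δ | cx η 0<η
  ... | M , hy | N , hx = (K ⊔ L) ⊔ (M ⊔ N) , λ m n p q →
    let K≤m = m⊔n≤o⇒m≤o K L (m⊔n≤o⇒m≤o (K ⊔ L) (M ⊔ N) p)
        L≤n = m⊔n≤o⇒n≤o K L (m⊔n≤o⇒m≤o (K ⊔ L) (M ⊔ N) q)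
        MN≤m = m⊔n≤o⇒n≤o (K ⊔ L) (M ⊔ N) p
        MN≤n = m⊔n≤o⇒n≤o (K ⊔ L) (M ⊔ N) q
    in begin-strict
    ℚ.∣ x m ℚ.* y m ℚ.- x n ℚ.* y n ∣
      ≡⟨ cong ℚ.∣_∣ (*-split (x m) (y m) (x n) (y n)) ⟩
    ℚ.∣ x m ℚ.* (y m ℚ.- y n) ℚ.+ y n ℚ.* (x m ℚ.- x n) ∣
      ≤⟨ ∣p+q∣≤∣p∣+∣q∣ (x m ℚ.* (y m ℚ.- y n)) _ ⟩
    ℚ.∣ x m ℚ.* (y m ℚ.- y n) ∣ ℚ.+ ℚ.∣ y n ℚ.* (x m ℚ.- x n) ∣
      <⟨ +-mono-<
           (∣*∣-< {x m} 0<B (bx m K≤m)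
             (hy m n (m⊔n≤o⇒m≤o M N MN≤m) (m⊔n≤o⇒m≤o M N MN≤n)))
           (∣*∣-< {y n} 0<C (by n L≤n)
             (hx m n (m⊔n≤o⇒n≤o M N MN≤m) (m⊔n≤o⇒n≤o M N MN≤n))) ⟩
    B ℚ.* δ ℚ.+ C ℚ.* η
      ≡⟨ cong₂ ℚ._+_ Bδ Cη ⟩
    ½ ℚ.* ε ℚ.+ ½ ℚ.* ε
      ≡⟨ half+half ε ⟩
    ε ∎
    where open ≤-Reasoning

_+ᴿ_ : ℝ → ℝ → ℝ
x +ᴿ y = mkℝ (λ n → seq x n ℚ.+ seq y n)
  (+-cauchy {seq x} {seq y} (cauchy x) (cauchy y))

-ᴿ_ : ℝ → ℝ
-ᴿ x = mkℝ (λ n → ℚ.- seq x n) (neg-cauchy {seq x} (cauchy x))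

_-ᴿ_ : ℝ → ℝ → ℝ
x -ᴿ y = x +ᴿ (-ᴿ y)

_*ᴿ_ : ℝ → ℝ → ℝ
x *ᴿ y = mkℝ (λ n → seq x n ℚ.* seq y n)
  (*-cauchy {seq x} {seq y} (cauchy x) (cauchy y))

fromℚ : ℚ → ℝ
fromℚ r = mkℝ (λ _ → r) λ ε 0<ε → 0 , λ _ _ _ _ →
  subst (ℚ._< ε) (sym (cong ℚ.∣_∣ (+-inverseʳ r))) 0<ε

fromℕ : ℕ → ℝ
fromℕ n = fromℚ (+ n ℚ./ 1)

-- n ^ a ≺ k says that the real power nᵃ is less than k, for a real exponent
-- a ≥ 0: here nᵃ is the infimum of the rational powers n^(p/s) with p/s > a,
-- and n^(p/s) < k is written without roots, as nᵖ < kˢ (with s = suc q).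

infix 4 _^_≺_

_^_≺_ : ℕ → ℝ → ℕ → Set
n ^ a ≺ k = ∃[ p ] ∃[ q ]
  (a <ᴿ fromℚ (+ p ℚ./ suc q) × n ℕ.^ p ℕ.< k ℕ.^ suc q)

-- Adjacency is a bare relation rather than a Boolean because equality of reals,
-- hence adjacency in G(P,S), is not decidable.
record Graph (n : ℕ) : Set₁ where
  field
    Adj    : Rel (Fin n) 0ℓ
    symm   : Symmetric Adj
    irrefl : ∀ v → ¬ Adj v v

open Graph public

Regular : ∀ {n} → ℕ → Graph n → Set
Regular {n} d G = ∀ v →
  Σ[ N ∈ Subset n ] ((∀ w → w ∈ N ⇔ Adj G v w) × ∣ N ∣ ≡ d)

infix 4 _≅_

_≅_ : ∀ {m n} → Graph m → Graph n → Set
_≅_ {m} {n} G H = Σ[ φ ∈ Fin m ↔ Fin n ]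
  (∀ v w → Adj G v w ⇔ Adj H (Inverse.to φ v) (Inverse.to φ w))

Point : Set
Point = ℝ × ℝ

_≈ᴾ_ : Rel Point 0ℓ
(x , y) ≈ᴾ (x′ , y′) = x ≈ᴿ x′ × y ≈ᴿ y′

-- ℝ ∪ {∞}, with nothing in the role of ∞.
Slope : Set
Slope = Maybe ℝ

_≈ˢ_ : Rel Slope 0ℓ
_≈ˢ_ = Pointwise _≈ᴿ_

-- HasSlope p q s: the line through the distinct points p and q has slope s.
data HasSlope : Point → Point → Slope → Set where
  vertical : ∀ {x y x′ y′} → x ≈ᴿ x′ → HasSlope (x , y) (x′ , y′) nothing
  finite   : ∀ {x y x′ y′ s} → ¬ (x ≈ᴿ x′) →
             s *ᴿ (x′ -ᴿ x) ≈ᴿ y′ -ᴿ y → HasSlope (x , y) (x′ , y′) (just s)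

-- Finite sets of points and of slopes, enumerated without repetition.

PointSet : ℕ → Set
PointSet m = Σ[ p ∈ (Fin m → Point) ] Injective _≡_ _≈ᴾ_ p

SlopeSet : ℕ → Set
SlopeSet k = Σ[ s ∈ (Fin k → Slope) ] Injective _≡_ _≈ˢ_ s

private

  slope-swap : ∀ s a b c d →
    (s ℚ.* (a ℚ.- b)) ℚ.- (c ℚ.- d) ≡ ℚ.- ((s ℚ.* (b ℚ.- a)) ℚ.- (d ℚ.- c))
  slope-swap s a b c d = trans
    (cong₂ ℚ._-_
      (trans (cong (s ℚ.*_) (diff-swap a b)) (sym (neg-distribʳ-* s (b ℚ.- a))))
      (diff-swap c d))
    (neg-split (s ℚ.* (b ℚ.- a)) (d ℚ.- c))

  ≈ᴿ-sym : Symmetric _≈ᴿ_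
  ≈ᴿ-sym {x} {y} x≈y ε 0<ε with x≈y ε 0<ε
  ... | N , h = N , λ n N≤n → subst (ℚ._< ε)
    (sym (trans (cong ℚ.∣_∣ (diff-swap (seq y n) (seq x n)))
                (∣-p∣≡∣p∣ (seq x n ℚ.- seq y n))))
    (h n N≤n)

  hasSlope-sym : ∀ {p q s} → HasSlope p q s → HasSlope q p s
  hasSlope-sym (vertical {x} {_} {x′} x≈x′) = vertical (≈ᴿ-sym {x} {x′} x≈x′)
  hasSlope-sym (finite {x} {y} {x′} {y′} {s} x≉x′ e) =
    finite (λ x′≈x → x≉x′ (≈ᴿ-sym {x′} {x} x′≈x)) λ ε 0<ε →
      proj₁ (e ε 0<ε) , λ n N≤n → subst (ℚ._< ε)
        (sym (trans
          (cong ℚ.∣_∣ (slope-swap (seq s n) (seq x n) (seq x′ n) (seq y n) (seq y′ n)))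
          (∣-p∣≡∣p∣ (seq s n ℚ.* (seq x′ n ℚ.- seq x n) ℚ.- (seq y′ n ℚ.- seq y n)))))
        (proj₂ (e ε 0<ε) n N≤n)

-- G(P,S)
slopeGraph : ∀ {m k} → PointSet m → SlopeSet k → Graph m
slopeGraph (p , _) (s , _) = record
  { Adj    = λ v w → v ≢ w × ∃[ j ] HasSlope (p v) (p w) (s j)
  ; symm   = λ (v≢w , j , h) → (λ w≡v → v≢w (sym w≡v)) , j , hasSlope-sym h
  ; irrefl = λ v (v≢v , _) → v≢v refl
  }

RealisableWith : ∀ {n} → Graph n → ℕ → Set
RealisableWith G k =
  ∃[ m ] Σ[ P ∈ PointSet m ] Σ[ S ∈ SlopeSet k ] (G ≅ slopeGraph P S)

-- IsSl G k says that sl(G) = k.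
IsSl : ∀ {n} → Graph n → ℕ → Set
IsSl G k = RealisableWith G k × (∀ j → RealisableWith G j → k ℕ.≤ j)

-- sl(G) > nᵃ. The minimum sl(G) exists only classically, realisability being
-- undecided constructively, so that sl(G) is defined is stated up to ¬¬; the
-- bound itself is not weakened.
record SlExceeds {m} (G : Graph m) (n : ℕ) (a : ℝ) : Set where
  field
    defined : ¬ ¬ (∃[ k ] IsSl G k)
    above   : ∀ k → IsSl G k → n ^ a ≺ k

{-# OPTIONS --safe #-}
module Submission where

-- For a graph on n vertices let g be the product, over its non-edges v ≠ w and K
-- slope variables, of the polynomials that vanish when the line through the points
-- v and w has the given slope. If G is realised by real points and slopes, then the
-- polynomial of G does not vanish there, while that of any other Δ-regular graph of
-- the family does, because G has an edge which is a non-edge of that graph. Hence in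
-- a linear dependence among the polynomials of a family, no graph with a nonzero
-- coefficient is realisable with K slopes. These polynomials have degree at most 2nK in each
-- point variable and n² in each slope variable, so they span a space of dimension
-- n^((2 + o(1)) n) K^(2n) if K = o(n), whereas there are n^((Δ/2 - o(1)) n) graphs
-- made of permutations between Δ + Δ blocks of vertices. The dependence is over ℚ and
-- is computed by elimination, which makes the choice of the graph constructive.

open import Defs
open import Algebra.Bundles using (module CommutativeRing)
import Algebra.Properties.CommutativeMonoid.Sum as MonoidSum
import Algebra.Properties.Semiring.Sum as SemiringSum
open import Data.Bool.Base using (Bool; true; false; if_then_else_)
open import Data.Fin.Base as Fin using (Fin; zero; suc; punchIn; splitAt; _↑ˡ_; toℕ; fromℕ<; remQuot; combine; finToFun; funToFin)
open import Data.Fin.Permutation as Permutation using (Permutation; _⟨$⟩ʳ_; _⟨$⟩ˡ_)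
open import Data.Fin.Properties as Finₚ using (any?; punchInᵢ≢i; splitAt-↑ˡ)
open import Data.Fin.Subset as Subset using (Subset; inside; outside; ⊥)
open import Data.Fin.Subset.Properties using (∉⊥; ∣⊥∣≡0)
open import Data.Integer.Base as ℤ using (+_; +[1+_]; -[1+_]; +<+)
import Data.Integer.Properties as ℤₚ
import Data.Integer.Tactic.RingSolver as ℤSolver
open import Data.List.Base as List using (List; []; _∷_; length; allFin; applyUpTo; cartesianProduct; cartesianProductWith; filter)
open import Data.List.Membership.Propositional using (_∈_)
open import Data.List.Membership.Propositional.Properties using (∈-allFin; ∈-applyUpTo⁺; ∈-cartesianProduct⁺; ∈-cartesianProductWith⁺; ∈-filter⁺; ∈-filter⁻; ∈-lookup)
open import Data.List.Properties using (length-map; length-++; length-applyUpTo)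
open import Data.List.Relation.Unary.All as All using (All; []; _∷_)
open import Data.List.Relation.Unary.AllPairs using ([]; _∷_)
open import Data.List.Relation.Unary.Any using (here; there; index)
open import Data.List.Relation.Unary.Any.Properties using (lookup-index)
open import Data.List.Relation.Unary.Unique.Propositional using (Unique)
import Data.List.Relation.Unary.Unique.Propositional.Properties as Uniqueₚ
open import Data.Maybe.Base using (just; nothing)
open import Data.Maybe.Relation.Binary.Pointwise using (just)
open import Data.Nat.Base as ℕ using (ℕ; zero; suc; _+_; _*_; _^_; _≤_; _<_; _>_; s≤s; z≤n; _⊔_; _!; NonZero; _%_)
open import Data.Nat.Divisibility using (_∣_; divides; ∣m∣n⇒∣m+n; ∣-refl; _∣0; %-presˡ-∣)
import Data.Nat.DivMod as DivMod
open import Data.Nat.Induction using (<-rec)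
open import Data.Nat.Primality using (euclidsLemma; prime[2])
import Data.Nat.Properties as ℕₚ
open import Data.Nat.Tactic.RingSolver using (solve-∀)
open import Data.Product.Base using (Σ-syntax; ∃-syntax; _×_; _,_; proj₁; proj₂; uncurry)
open import Data.Product.Properties using (,-injectiveˡ; ,-injectiveʳ)
open import Data.Rational.Base as ℚ using (ℚ; mkℚ; 0ℚ; 1ℚ; ½; _/_)
import Data.Rational.Properties as ℚₚ
open import Data.Rational.Solver using (module +-*-Solver)
open import Data.Rational.Unnormalised.Base as ℚᵘ using (mkℚᵘ; *≡*; *<*)
import Data.Rational.Unnormalised.Properties as ℚᵘₚ
open import Data.Sum.Base using (_⊎_; inj₁; inj₂; [_,_])
open import Data.Sum.Function.Propositional using (_⊎-↔_)
open import Data.Sum.Properties using (inj₁-injective; inj₂-injective)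
open import Data.Vec.Base as Vec using (Vec; []; _∷_; here; there; lookup; tabulate; _[_]≔_)
open import Data.Vec.Functional using (insertAt)
open import Data.Vec.Functional.Properties using (insertAt-lookup; insertAt-punchIn)
open import Data.Vec.Properties using ([]≔-updates; []≔-minimal; lookup∘tabulate; lookup∘update′; []=⇒lookup; lookup⇒[]=)
open import Function.Base using (_∘_; case_of_; const; id)
open import Function.Bundles using (_⇔_; _↔_; Inverse; Equivalence; mk⇔)
open import Function.Construct.Composition using (_↔-∘_)
open import Function.Construct.Identity using (↔-id)
open import Function.Definitions using (Injective)
open import Relation.Binary.Definitions using (Decidable; tri<; tri≈; tri>)
open import Relation.Binary.PropositionalEquality hiding ([_])
open import Relation.Nullary using (¬_; Dec; yes; no; does; ¬?; contradiction; _×-dec_)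
open import Relation.Nullary.Decidable using (dec-true; decidable-stable)

-- Linear dependence

-- The exponent comes from comparing K^(2n) with n^((Δ/2 - 2) n): the family outgrows the space as
-- long as K stays below n^((Δ - 4)/4) by a fixed power of n. The slope variables contribute a
-- factor n^O(K), negligible because Δ ≤ 8 keeps this K below a power of n with exponent less than
-- 1. Graphs are counted with labels, and nothing is lost for isomorphism, since an isomorphism onto
-- G(P, S) only relabels the points. The obstacle is constructive: equality of reals is undecidable,
-- so zeros at a real configuration cannot be computed. Hence the linear algebra happens at finitely
-- many rational grid points, where a degree argument turns vanishing into an identity over ℚ. The
-- identity holds along rational approximations of any real configuration, and the contradiction
-- appears in the limit, where a doubly negated lower bound suffices.

module ∑ℚ = SemiringSum (CommutativeRing.semiring ℚₚ.+-*-commutativeRing)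
module ∏ℚ = MonoidSum ℚₚ.*-1-commutativeMonoid
module ∑ℕ = SemiringSum ℕₚ.+-*-semiring

∑ ∏ : ∀ {n} → (Fin n → ℚ) → ℚ
∑ = ∑ℚ.sum
∏ = ∏ℚ.sum

back : ∀ p q → p ≡ (p ℚ.- q) ℚ.+ q
back = solve 2 (λ p q → p := (p :- q) :+ q) refl
  where open +-*-Solver

*-zero-product : ∀ p q → p ≢ 0ℚ → p ℚ.* q ≡ 0ℚ → q ≡ 0ℚ
*-zero-product p q p≢0 pq≡0 = begin
  q                      ≡⟨ ℚₚ.*-identityˡ q ⟨
  1ℚ ℚ.* q               ≡⟨ cong (ℚ._* q) (ℚₚ.*-inverseˡ p) ⟨
  ℚ.1/ p ℚ.* p ℚ.* q     ≡⟨ ℚₚ.*-assoc (ℚ.1/ p) p q ⟩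
  ℚ.1/ p ℚ.* (p ℚ.* q)   ≡⟨ cong (ℚ.1/ p ℚ.*_) pq≡0 ⟩
  ℚ.1/ p ℚ.* 0ℚ          ≡⟨ ℚₚ.*-zeroʳ (ℚ.1/ p) ⟩
  0ℚ                     ∎
  where
  open ≡-Reasoning
  instance
    p-nonZero : ℚ.NonZero p
    p-nonZero = ℚ.≢-nonZero p≢0

combination : ∀ {X : Set} {M} → (Fin M → ℚ) → (Fin M → X → ℚ) → X → ℚ
combination c g x = ∑ (λ i → c i ℚ.* g i x)

-- Gaussian elimination with pivot `g i₀ p`. Cross multiplication clears the point p without
-- division; `coefficients` carries a relation between the eliminated functions back to the original
-- ones.
module Elimination {X : Set} {M} (g : Fin (suc M) → X → ℚ) (p : X) (i₀ : Fin (suc M)) where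

  eliminated : Fin M → X → ℚ
  eliminated i x = g i₀ p ℚ.* g (punchIn i₀ i) x ℚ.- g (punchIn i₀ i) p ℚ.* g i₀ x

  coefficients : (Fin M → ℚ) → Fin (suc M) → ℚ
  coefficients c = insertAt (λ i → c i ℚ.* g i₀ p) i₀
    (ℚ.- ∑ (λ i → c i ℚ.* g (punchIn i₀ i) p))

  combination-eliminated : ∀ c x →
    combination (coefficients c) g x ≡ combination c eliminated x
  combination-eliminated c x = begin
    combination (coefficients c) g x
      ≡⟨ ∑ℚ.sum-remove {i = i₀} (λ i → coefficients c i ℚ.* g i x) ⟩
    coefficients c i₀ ℚ.* y ℚ.+ ∑ (λ i → coefficients c (punchIn i₀ i) ℚ.* g (punchIn i₀ i) x)
      ≡⟨ cong₂ (λ a b → a ℚ.* y ℚ.+ b) (insertAt-lookup _ i₀ _)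
           (∑ℚ.sum-cong-≗ λ i → cong (ℚ._* g (punchIn i₀ i) x) (insertAt-punchIn _ i₀ _ i)) ⟩
    (ℚ.- s) ℚ.* y ℚ.+ t
      ≡⟨ solve 3 (λ s y t → (:- s) :* y :+ t := t :+ s :* (:- y)) refl s y t ⟩
    t ℚ.+ s ℚ.* (ℚ.- y)
      ≡⟨ cong (t ℚ.+_) (∑ℚ.*-distribʳ-sum (ℚ.- y) (λ i → c i ℚ.* g (punchIn i₀ i) p)) ⟩
    t ℚ.+ ∑ (λ i → c i ℚ.* g (punchIn i₀ i) p ℚ.* (ℚ.- y))
      ≡⟨ ∑ℚ.∑-distrib-+ (λ i → c i ℚ.* g i₀ p ℚ.* g (punchIn i₀ i) x) _ ⟨
    ∑ (λ i → c i ℚ.* g i₀ p ℚ.* g (punchIn i₀ i) x ℚ.+ c i ℚ.* g (punchIn i₀ i) p ℚ.* (ℚ.- y))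
      ≡⟨ ∑ℚ.sum-cong-≗ (λ i → solve 5
           (λ c a u v y → c :* a :* u :+ c :* v :* (:- y) := c :* (a :* u :- v :* y))
           refl (c i) (g i₀ p) (g (punchIn i₀ i) x) (g (punchIn i₀ i) p) y) ⟩
    combination c eliminated x ∎
    where
    open ≡-Reasoning
    open +-*-Solver
    y s t : ℚ
    y = g i₀ x
    s = ∑ (λ i → c i ℚ.* g (punchIn i₀ i) p)
    t = ∑ (λ i → c i ℚ.* g i₀ p ℚ.* g (punchIn i₀ i) x)

  eliminated-vanishes : ∀ i → eliminated i p ≡ 0ℚ
  eliminated-vanishes i = solve 2 (λ a b → a :* b :- b :* a := con 0ℚ) refl
    (g i₀ p) (g (punchIn i₀ i) p)
    where open +-*-Solver

combination-zero : ∀ {X : Set} {M} (c : Fin M → ℚ) (g : Fin M → X → ℚ) x →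
  (∀ i → g i x ≡ 0ℚ) → combination c g x ≡ 0ℚ
combination-zero {M = M} c g x gx≡0 = trans
  (∑ℚ.sum-cong-≗ λ i → trans (cong (c i ℚ.*_) (gx≡0 i)) (ℚₚ.*-zeroʳ (c i)))
  (∑ℚ.sum-replicate-zero M)

-- Each point uses up at most one function: either all functions vanish there already, or a pivot
-- exists and elimination leaves one function fewer, all of them zero at that point. The choice is
-- decidable because values are rational.
dependence : ∀ {X : Set} {M} (g : Fin M → X → ℚ) (xs : List X) → length xs < M →
  ∃[ c ] ((∃[ i ] c i ≢ 0ℚ) × All (λ x → combination c g x ≡ 0ℚ) xs)
dependence {M = suc M} g [] _ = (λ _ → 1ℚ) , (zero , λ ()) , []
dependence {M = suc M} g (p ∷ xs) (s≤s l<M) with any? (λ i → ¬? (g i p ℚₚ.≟ 0ℚ))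
... | no  ∄i with dependence g xs (ℕₚ.m<n⇒m<1+n l<M)
...   | c , nonzero , vanish = c , nonzero
        , combination-zero c g p (λ i → decidable-stable (g i p ℚₚ.≟ 0ℚ) (λ ≢0 → ∄i (i , ≢0))) ∷ vanish
dependence {M = suc M} g (p ∷ xs) (s≤s l<M) | yes (i₀ , a≢0)
  with dependence (Elimination.eliminated g p i₀) xs l<M
... | c , (i , ci≢0) , vanish = coefficients c , (punchIn i₀ i , nonzero)
        , trans (combination-eliminated c p) (combination-zero c eliminated p eliminated-vanishes)
          ∷ All.map (λ {x} → trans (combination-eliminated c x)) vanish
  where
  open Elimination g p i₀
  nonzero : coefficients c (punchIn i₀ i) ≢ 0ℚ
  nonzero eq = a≢0 (*-zero-product (c i) _ ci≢0 (trans (sym (insertAt-punchIn _ i₀ _ i)) eq))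

-- Polynomial functions

-- Horner form on the level of functions: no coefficient list is kept, and leading coefficients may
-- be zero, so the index is only an upper bound.
data Deg≤ : ℕ → (ℚ → ℚ) → Set where
  constant : ∀ {φ} c → (∀ x → φ x ≡ c) → Deg≤ 0 φ
  horner   : ∀ {d φ ψ} c → Deg≤ d ψ → (∀ x → φ x ≡ c ℚ.+ x ℚ.* ψ x) → Deg≤ (suc d) φ

Deg≤-resp : ∀ {d φ ψ} → (∀ x → ψ x ≡ φ x) → Deg≤ d φ → Deg≤ d ψ
Deg≤-resp eq (constant c h) = constant c λ x → trans (eq x) (h x)
Deg≤-resp eq (horner c p h) = horner c p λ x → trans (eq x) (h x)

Deg≤-suc : ∀ {d φ} → Deg≤ d φ → Deg≤ (suc d) φ
Deg≤-suc (constant c h) = horner c (constant 0ℚ λ _ → refl) λ x →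
  trans (h x) (solve 2 (λ c x → c := c :+ x :* con 0ℚ) refl c x)
  where open +-*-Solver
Deg≤-suc (horner c p h) = horner c (Deg≤-suc p) h

Deg≤-+ˡ : ∀ e {d φ} → Deg≤ d φ → Deg≤ (e + d) φ
Deg≤-+ˡ zero    p = p
Deg≤-+ˡ (suc e) p = Deg≤-suc (Deg≤-+ˡ e p)

Deg≤-+ʳ : ∀ e {d φ} → Deg≤ d φ → Deg≤ (d + e) φ
Deg≤-+ʳ e {d} {φ} p = subst (λ k → Deg≤ k φ) (ℕₚ.+-comm e d) (Deg≤-+ˡ e p)

Deg≤-const : ∀ d c → Deg≤ d (λ _ → c)
Deg≤-const d c = Deg≤-+ʳ d (constant c λ _ → refl)

Deg≤-id : Deg≤ 1 (λ x → x)
Deg≤-id = horner 0ℚ (constant 1ℚ λ _ → refl) λ x →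
  solve 1 (λ x → x := con 0ℚ :+ x :* con 1ℚ) refl x
  where open +-*-Solver

Deg≤-scale : ∀ {d φ} a → Deg≤ d φ → Deg≤ d (λ x → a ℚ.* φ x)
Deg≤-scale a (constant c h) = constant (a ℚ.* c) λ x → cong (a ℚ.*_) (h x)
Deg≤-scale a (horner {ψ = ψ} c p h) = horner (a ℚ.* c) (Deg≤-scale a p) λ x →
  trans (cong (a ℚ.*_) (h x))
    (solve 4 (λ a c x y → a :* (c :+ x :* y) := a :* c :+ x :* (a :* y)) refl a c x (ψ x))
  where open +-*-Solver

Deg≤-add : ∀ {d φ ψ} → Deg≤ d φ → Deg≤ d ψ → Deg≤ d (λ x → φ x ℚ.+ ψ x)
Deg≤-add (constant c h) (constant d k) = constant (c ℚ.+ d) λ x → cong₂ ℚ._+_ (h x) (k x)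
Deg≤-add (horner {ψ = φ} c p h) (horner {ψ = ψ} d q k) = horner (c ℚ.+ d) (Deg≤-add p q) λ x →
  trans (cong₂ ℚ._+_ (h x) (k x))
    (solve 5 (λ c d x y z → (c :+ x :* y) :+ (d :+ x :* z) := (c :+ d) :+ x :* (y :+ z))
      refl c d x (φ x) (ψ x))
  where open +-*-Solver

Deg≤-neg : ∀ {d φ} → Deg≤ d φ → Deg≤ d (λ x → ℚ.- φ x)
Deg≤-neg {φ = φ} p = Deg≤-resp
  (λ x → solve 1 (λ y → :- y := con (ℚ.- 1ℚ) :* y) refl (φ x)) (Deg≤-scale (ℚ.- 1ℚ) p)
  where open +-*-Solver

Deg≤-mul : ∀ {d e φ ψ} → Deg≤ d φ → Deg≤ e ψ → Deg≤ (d + e) (λ x → φ x ℚ.* ψ x)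
Deg≤-mul {ψ = ψ} (constant c h) q =
  Deg≤-resp (λ x → cong (ℚ._* ψ x) (h x)) (Deg≤-scale c q)
Deg≤-mul {suc d} {e} {ψ = ψ} (horner {ψ = φ} c p h) q = Deg≤-resp
  (λ x → trans (cong (ℚ._* ψ x) (h x))
    (solve 4 (λ c x y z → (c :+ x :* y) :* z := c :* z :+ (con 0ℚ :+ x :* (y :* z)))
      refl c x (φ x) (ψ x)))
  (Deg≤-add (Deg≤-+ˡ (suc d) (Deg≤-scale c q))
    (horner 0ℚ (Deg≤-mul p q) λ _ → refl))
  where open +-*-Solver

Deg≤-∑ : ∀ {n d} {φ : Fin n → ℚ → ℚ} → (∀ i → Deg≤ d (φ i)) → Deg≤ d (λ x → ∑ (λ i → φ i x))
Deg≤-∑ {zero}  {d} p = Deg≤-const d 0ℚ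
Deg≤-∑ {suc n} p = Deg≤-add (p zero) (Deg≤-∑ (p ∘ suc))

Deg≤-∏ : ∀ {n} {d : Fin n → ℕ} {φ : Fin n → ℚ → ℚ} → (∀ i → Deg≤ (d i) (φ i)) →
  Deg≤ (∑ℕ.sum d) (λ x → ∏ (λ i → φ i x))
Deg≤-∏ {zero}  p = constant 1ℚ λ _ → refl
Deg≤-∏ {suc n} p = Deg≤-mul (p zero) (Deg≤-∏ (p ∘ suc))

-- Synthetic division: if χ is the quotient of ψ by x - r, then ψ + rχ is the quotient of c + xψ.
factor-theorem : ∀ {d φ} r → Deg≤ (suc d) φ →
  ∃[ ψ ] (Deg≤ d ψ × (∀ x → φ x ≡ (x ℚ.- r) ℚ.* ψ x ℚ.+ φ r))
factor-theorem {zero} {φ} r (horner {ψ = ψ} c (constant e k) h) =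
  (λ _ → e) , (constant e λ _ → refl) , λ x → begin
    φ x                                    ≡⟨ trans (h x) (cong (λ z → c ℚ.+ x ℚ.* z) (k x)) ⟩
    c ℚ.+ x ℚ.* e
      ≡⟨ solve 4 (λ c x r e → c :+ x :* e := (x :- r) :* e :+ (c :+ r :* e)) refl c x r e ⟩
    (x ℚ.- r) ℚ.* e ℚ.+ (c ℚ.+ r ℚ.* e)
      ≡⟨ cong ((x ℚ.- r) ℚ.* e ℚ.+_) (trans (h r) (cong (λ z → c ℚ.+ r ℚ.* z) (k r))) ⟨
    (x ℚ.- r) ℚ.* e ℚ.+ φ r                ∎
  where
  open +-*-Solver
  open ≡-Reasoning
factor-theorem {suc d} {φ} r (horner {ψ = ψ} c p h) with factor-theorem r p
... | χ , q , k = (λ x → ψ x ℚ.+ r ℚ.* χ x) , Deg≤-add p (Deg≤-suc (Deg≤-scale r q)) , λ x → begin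
    φ x
      ≡⟨ h x ⟩
    c ℚ.+ x ℚ.* ψ x
      ≡⟨ solve 4 (λ c x r y → c :+ x :* y := c :+ (x :- r) :* y :+ r :* y) refl c x r (ψ x) ⟩
    c ℚ.+ (x ℚ.- r) ℚ.* ψ x ℚ.+ r ℚ.* ψ x
      ≡⟨ cong (λ z → c ℚ.+ (x ℚ.- r) ℚ.* ψ x ℚ.+ r ℚ.* z) (k x) ⟩
    c ℚ.+ (x ℚ.- r) ℚ.* ψ x ℚ.+ r ℚ.* ((x ℚ.- r) ℚ.* χ x ℚ.+ ψ r)
      ≡⟨ solve 6 (λ c x r y z w → c :+ (x :- r) :* y :+ r :* ((x :- r) :* z :+ w)
           := (x :- r) :* (y :+ r :* z) :+ (c :+ r :* w)) refl c x r (ψ x) (χ x) (ψ r) ⟩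
    (x ℚ.- r) ℚ.* (ψ x ℚ.+ r ℚ.* χ x) ℚ.+ (c ℚ.+ r ℚ.* ψ r)
      ≡⟨ cong ((x ℚ.- r) ℚ.* (ψ x ℚ.+ r ℚ.* χ x) ℚ.+_) (h r) ⟨
    (x ℚ.- r) ℚ.* (ψ x ℚ.+ r ℚ.* χ x) ℚ.+ φ r ∎
  where
  open +-*-Solver
  open ≡-Reasoning

node : ℕ → ℚ
node zero    = 0ℚ
node (suc i) = 1ℚ ℚ.+ node i

node-<-suc : ∀ i → node i ℚ.< node (suc i)
node-<-suc i = subst (ℚ._< node (suc i)) (ℚₚ.+-identityˡ (node i))
  (ℚₚ.+-monoˡ-< (node i) {0ℚ} {1ℚ} (ℚₚ.positive⁻¹ 1ℚ))

node-mono : ∀ {i j} → i < j → node i ℚ.< node j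
node-mono {i} {suc j} (s≤s i≤j) with ℕₚ.m≤n⇒m<n∨m≡n i≤j
... | inj₁ i<j  = ℚₚ.<-trans (node-mono i<j) (node-<-suc j)
... | inj₂ refl = node-<-suc i

-- Dividing by x - r for the last node r leaves a quotient of smaller degree, which inherits the
-- other roots because the nodes differ.
Deg≤-vanish : ∀ {d φ} → Deg≤ d φ → (∀ i → i ≤ d → φ (node i) ≡ 0ℚ) → ∀ x → φ x ≡ 0ℚ
Deg≤-vanish (constant c h) roots x = trans (h x) (trans (sym (h 0ℚ)) (roots 0 z≤n))
Deg≤-vanish {suc d} {φ} p@(horner _ _ _) roots x with factor-theorem (node (suc d)) p
... | ψ , q , k = trans (φ≡ x)
    (trans (cong ((x ℚ.- r) ℚ.*_) (Deg≤-vanish q ψ-roots x)) (ℚₚ.*-zeroʳ (x ℚ.- r)))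
  where
  r : ℚ
  r = node (suc d)
  φ≡ : ∀ x → φ x ≡ (x ℚ.- r) ℚ.* ψ x
  φ≡ x = trans (k x) (trans (cong ((x ℚ.- r) ℚ.* ψ x ℚ.+_) (roots (suc d) ℕₚ.≤-refl))
    (ℚₚ.+-identityʳ _))
  ψ-roots : ∀ i → i ≤ d → ψ (node i) ≡ 0ℚ
  ψ-roots i i≤d = *-zero-product (node i ℚ.- r) _
    (λ eq → ℚₚ.<⇒≢ (node-mono (s≤s i≤d))
      (trans (back (node i) r) (trans (cong (ℚ._+ r) eq) (ℚₚ.+-identityˡ r))))
    (trans (sym (φ≡ (node i))) (roots i (ℕₚ.m≤n⇒m≤1+n i≤d)))

DegEach≤ : ∀ {n} → ℕ → (Vec ℚ n → ℚ) → Set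
DegEach≤ d f = ∀ i x → Deg≤ d (λ y → f (x [ i ]≔ y))

length-cartesianProductWith : ∀ {A B C : Set} (f : A → B → C) xs ys →
  length (cartesianProductWith f xs ys) ≡ length xs * length ys
length-cartesianProductWith f []       ys = refl
length-cartesianProductWith f (x ∷ xs) ys = trans (length-++ (List.map (f x) ys))
  (cong₂ _+_ (length-map (f x) ys) (length-cartesianProductWith f xs ys))

grid : ∀ n → ℕ → List (Vec ℚ n)
grid zero    d = [] ∷ []
grid (suc n) d = cartesianProductWith _∷_ (applyUpTo node (suc d)) (grid n d)

length-grid : ∀ n d → length (grid n d) ≡ suc d ^ n
length-grid zero    d = refl
length-grid (suc n) d = trans (length-cartesianProductWith _∷_ (applyUpTo node (suc d)) (grid n d))
  (cong₂ _*_ (length-applyUpTo node (suc d)) (length-grid n d))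

-- With the tail fixed, the first coordinate has d + 1 roots. The grid has as many points as there
-- are monomials of degree at most d in each variable, so nothing is lost against a dimension count.
grid-vanish : ∀ n {d} {f : Vec ℚ n → ℚ} → DegEach≤ d f →
  (∀ x → x ∈ grid n d → f x ≡ 0ℚ) → ∀ x → f x ≡ 0ℚ
grid-vanish zero    deg zeros []       = zeros [] (here refl)
grid-vanish (suc n) {d} {f} deg zeros (x ∷ xs) = Deg≤-vanish (deg zero (x ∷ xs)) first x
  where
  first : ∀ i → i ≤ d → f (node i ∷ xs) ≡ 0ℚ
  first i i≤d = grid-vanish n (λ j ys → deg (suc j) (node i ∷ ys))
    (λ ys ys∈ → zeros (node i ∷ ys)
      (∈-cartesianProductWith⁺ _∷_ (∈-applyUpTo⁺ node (s≤s i≤d)) ys∈)) xs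

-- Graph polynomials

-- Slopes are homogeneous coordinates (a : b), standing for b / a, with ∞ = (0 : 1).
record Configuration (n K : ℕ) : Set where
  constructor config
  field
    xs ys : Vec ℚ n
    as bs : Vec ℚ K

-- The cross product of the direction (a, b) with the displacement between the two points; it treats
-- ∞ like any other slope.
incidence : (a b x y x′ y′ : ℚ) → ℚ
incidence a b x y x′ y′ = a ℚ.* (y′ ℚ.- y) ℚ.- b ℚ.* (x′ ℚ.- x)

pairProduct : ∀ {n K} (x y : Fin n → ℚ) (a b : Fin K → ℚ) → Fin n → Fin n → ℚ
pairProduct x y a b v w = ∏ (λ j → incidence (a j) (b j) (x v) (y v) (x w) (y w))

selectedProduct : ∀ {n K} → (Fin n → Fin n → Bool) → (x y : Fin n → ℚ) (a b : Fin K → ℚ) → ℚ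
selectedProduct B x y a b = ∏ λ v → ∏ λ w →
  if B v w then pairProduct x y a b v w else 1ℚ

graphPolynomial : ∀ {n K} → (Fin n → Fin n → Bool) → Configuration n K → ℚ
graphPolynomial B (config xs ys as bs) =
  selectedProduct B (lookup xs) (lookup ys) (lookup as) (lookup bs)

Deg≤-if : ∀ {d φ} b → Deg≤ d φ → Deg≤ d (λ x → if b then φ x else 1ℚ)
Deg≤-if         true  p = p
Deg≤-if {d} false p = Deg≤-const d 1ℚ

-- Degrees are measured in a single variable t, with all other coordinates constant. The sum d v + d
-- w replaces a maximum; for d = `δ u` the two differ only at v = w = u.
Deg≤-selectedProduct : ∀ {n K} B {x y : Fin n → ℚ → ℚ} {a b : Fin K → ℚ → ℚ} (d : Fin n → ℕ) (e : Fin K → ℕ) →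
  (∀ v → Deg≤ (d v) (x v)) → (∀ v → Deg≤ (d v) (y v)) →
  (∀ j → Deg≤ (e j) (a j)) → (∀ j → Deg≤ (e j) (b j)) →
  Deg≤ (∑ℕ.sum λ v → ∑ℕ.sum λ w → ∑ℕ.sum λ j → e j + (d v + d w))
    (λ t → selectedProduct B (λ v → x v t) (λ v → y v t) (λ j → a j t) (λ j → b j t))
Deg≤-selectedProduct B {x} {y} {a} {b} d e px py pa pb =
  Deg≤-∏ λ v → Deg≤-∏ λ w → Deg≤-if (B v w) (Deg≤-∏ λ j →
    Deg≤-add (Deg≤-mul (pa j) (diff (d v) (d w) (py v) (py w)))
             (Deg≤-neg (Deg≤-mul (pb j) (diff (d v) (d w) (px v) (px w)))))
  where
  diff : ∀ {φ ψ} k l → Deg≤ k φ → Deg≤ l ψ → Deg≤ (k + l) (λ t → ψ t ℚ.- φ t)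
  diff k l p q = Deg≤-add (Deg≤-+ˡ k q) (Deg≤-neg (Deg≤-+ʳ l p))

δ : ∀ {n} → Fin n → Fin n → ℕ
δ zero    zero    = 1
δ zero    (suc _) = 0
δ (suc _) zero    = 0
δ (suc i) (suc j) = δ i j

sum-const : ∀ n k → ∑ℕ.sum {n} (λ _ → k) ≡ n * k
sum-const zero    k = refl
sum-const (suc n) k = cong (λ z → k + z) (sum-const n k)

sum-δ : ∀ {n} (i : Fin n) → ∑ℕ.sum (δ i) ≡ 1
sum-δ {suc n} zero    = cong suc (trans (sum-const n 0) (ℕₚ.*-zeroʳ n))
sum-δ         (suc i) = sum-δ i

Deg≤-lookup-update : ∀ {n} (x : Vec ℚ n) i j → Deg≤ (δ i j) (λ t → lookup (x [ i ]≔ t) j)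
Deg≤-lookup-update (x ∷ xs) zero    zero    = Deg≤-id
Deg≤-lookup-update (x ∷ xs) zero    (suc j) = Deg≤-const 0 (lookup xs j)
Deg≤-lookup-update (x ∷ xs) (suc i) zero    = Deg≤-const 0 x
Deg≤-lookup-update (x ∷ xs) (suc i) (suc j) = Deg≤-lookup-update xs i j

point-degree : ∀ {n} K (u : Fin n) →
  (∑ℕ.sum λ v → ∑ℕ.sum λ w → ∑ℕ.sum {K} λ j → 0 + (δ u v + δ u w)) ≡ K * (n + n)
point-degree {n} K u = begin
  (∑ℕ.sum λ v → ∑ℕ.sum λ w → ∑ℕ.sum {K} λ j → δ u v + δ u w)
    ≡⟨ ∑ℕ.sum-cong-≗ (λ v → trans (∑ℕ.sum-cong-≗ λ w → sum-const K (δ u v + δ u w))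
         (sym (∑ℕ.*-distribˡ-sum K (λ w → δ u v + δ u w)))) ⟩
  (∑ℕ.sum λ v → K * ∑ℕ.sum λ w → δ u v + δ u w)
    ≡⟨ ∑ℕ.*-distribˡ-sum K (λ v → ∑ℕ.sum λ w → δ u v + δ u w) ⟨
  K * (∑ℕ.sum λ v → ∑ℕ.sum λ w → δ u v + δ u w)
    ≡⟨ cong (K *_) (∑ℕ.sum-cong-≗ λ v → trans (∑ℕ.∑-distrib-+ {n} (λ _ → δ u v) (δ u))
         (cong₂ _+_ (sum-const n (δ u v)) (sum-δ u))) ⟩
  K * (∑ℕ.sum λ v → n * δ u v + 1)
    ≡⟨ cong (K *_) (∑ℕ.∑-distrib-+ {n} (λ v → n * δ u v) (λ _ → 1)) ⟩
  K * (∑ℕ.sum (λ v → n * δ u v) + ∑ℕ.sum {n} (λ _ → 1))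
    ≡⟨ cong (K *_) (cong₂ _+_ (sym (∑ℕ.*-distribˡ-sum n (δ u))) (sum-const n 1)) ⟩
  K * (n * ∑ℕ.sum (δ u) + n * 1)
    ≡⟨ cong (λ s → K * (n * s + n * 1)) (sum-δ u) ⟩
  K * (n * 1 + n * 1)
    ≡⟨ cong (λ m → K * (m + m)) (ℕₚ.*-identityʳ n) ⟩
  K * (n + n) ∎
  where open ≡-Reasoning

slope-degree : ∀ n {K} (l : Fin K) →
  (∑ℕ.sum {n} λ v → ∑ℕ.sum {n} λ w → ∑ℕ.sum λ j → δ l j + (0 + 0)) ≡ n * n
slope-degree n l = begin
  (∑ℕ.sum {n} λ v → ∑ℕ.sum {n} λ w → ∑ℕ.sum λ j → δ l j + 0)
    ≡⟨ ∑ℕ.sum-cong-≗ (λ (v : Fin n) → ∑ℕ.sum-cong-≗ λ (w : Fin n) →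
         trans (∑ℕ.sum-cong-≗ λ j → ℕₚ.+-identityʳ (δ l j)) (sum-δ l)) ⟩
  (∑ℕ.sum {n} λ v → ∑ℕ.sum {n} λ w → 1)
    ≡⟨ sum-const n (∑ℕ.sum {n} λ w → 1) ⟩
  n * (∑ℕ.sum {n} λ w → 1)
    ≡⟨ cong (n *_) (trans (sum-const n 1) (ℕₚ.*-identityʳ n)) ⟩
  n * n ∎
  where open ≡-Reasoning

configurationGrid : ∀ n K → List (Configuration n K)
configurationGrid n K = cartesianProductWith (λ { (xs , ys) (as , bs) → config xs ys as bs })
  (cartesianProduct (grid n (K * (n + n))) (grid n (K * (n + n))))
  (cartesianProduct (grid K (n * n)) (grid K (n * n)))

gridSize : ℕ → ℕ → ℕ
gridSize n K = (suc (K * (n + n)) ^ n * suc (K * (n + n)) ^ n) * (suc (n * n) ^ K * suc (n * n) ^ K)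

length-configurationGrid : ∀ n K → length (configurationGrid n K) ≡ gridSize n K
length-configurationGrid n K = trans
  (length-cartesianProductWith _ (cartesianProduct (grid n d) (grid n d)) (cartesianProduct (grid K e) (grid K e)))
  (cong₂ _*_
    (trans (length-cartesianProductWith _,_ (grid n d) (grid n d))
           (cong₂ _*_ (length-grid n d) (length-grid n d)))
    (trans (length-cartesianProductWith _,_ (grid K e) (grid K e))
           (cong₂ _*_ (length-grid K e) (length-grid K e))))
  where
  d e : ℕ
  d = K * (n + n)
  e = n * n

Deg≤-graphPolynomial-point : ∀ {n K} B (as bs : Vec ℚ K) u (f g : ℚ → Vec ℚ n) →
  (∀ v → Deg≤ (δ u v) (λ t → lookup (f t) v)) → (∀ v → Deg≤ (δ u v) (λ t → lookup (g t) v)) →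
  Deg≤ (K * (n + n)) (λ t → graphPolynomial B (config (f t) (g t) as bs))
Deg≤-graphPolynomial-point {K = K} B as bs u f g pf pg = subst (λ d → Deg≤ d _) (point-degree K u)
  (Deg≤-selectedProduct B (δ u) (λ _ → 0) pf pg (λ j → Deg≤-const 0 (lookup as j)) (λ j → Deg≤-const 0 (lookup bs j)))

Deg≤-graphPolynomial-slope : ∀ {n K} B (xs ys : Vec ℚ n) (l : Fin K) (f g : ℚ → Vec ℚ K) →
  (∀ j → Deg≤ (δ l j) (λ t → lookup (f t) j)) → (∀ j → Deg≤ (δ l j) (λ t → lookup (g t) j)) →
  Deg≤ (n * n) (λ t → graphPolynomial B (config xs ys (f t) (g t)))
Deg≤-graphPolynomial-slope {n} B xs ys l f g pf pg = subst (λ d → Deg≤ d _) (slope-degree n l)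
  (Deg≤-selectedProduct B (λ _ → 0) (δ l) (λ v → Deg≤-const 0 (lookup xs v)) (λ v → Deg≤-const 0 (lookup ys v)) pf pg)

-- A dependence on the grid extends to all configurations. The groups of variables are freed one
-- after another, because point and slope coordinates have different degree bounds.
graphPolynomial-dependence : ∀ {n K M} (B : Fin M → Fin n → Fin n → Bool) → gridSize n K < M →
  ∃[ c ] ((∃[ i ] c i ≢ 0ℚ) ×
          (∀ (x : Configuration n K) → combination c (graphPolynomial ∘ B) x ≡ 0ℚ))
graphPolynomial-dependence {n} {K} {M} B size<M
  with dependence (graphPolynomial ∘ B) (configurationGrid n K)
         (subst (_< M) (sym (length-configurationGrid n K)) size<M)
... | c , nonzero , zeros = c , nonzero , λ { (config xs ys as bs) →
  grid-vanish n
    (λ u xs → combination-deg (λ i → Deg≤-graphPolynomial-point (B i) as bs u (xs [ u ]≔_) (λ _ → ys)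
      (Deg≤-lookup-update xs u) (λ v → Deg≤-const (δ u v) (lookup ys v))))
    (λ xs xs∈ → grid-vanish n
      (λ u ys → combination-deg (λ i → Deg≤-graphPolynomial-point (B i) as bs u (λ _ → xs) (ys [ u ]≔_)
        (λ v → Deg≤-const (δ u v) (lookup xs v)) (Deg≤-lookup-update ys u)))
      (λ ys ys∈ → grid-vanish K
        (λ l as → combination-deg (λ i → Deg≤-graphPolynomial-slope (B i) xs ys l (as [ l ]≔_) (λ _ → bs)
          (Deg≤-lookup-update as l) (λ j → Deg≤-const (δ l j) (lookup bs j))))
        (λ as as∈ → grid-vanish K
          (λ l bs → combination-deg (λ i → Deg≤-graphPolynomial-slope (B i) xs ys l (λ _ → as) (bs [ l ]≔_)
            (λ j → Deg≤-const (δ l j) (lookup as j)) (Deg≤-lookup-update bs l)))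
          (λ bs bs∈ → All.lookup zeros (∈-cartesianProductWith⁺ _
            (∈-cartesianProduct⁺ xs∈ ys∈) (∈-cartesianProduct⁺ as∈ bs∈)))
          bs) as) ys) xs }
  where
  combination-deg : ∀ {d} {φ : Fin M → ℚ → ℚ} → (∀ i → Deg≤ d (φ i)) → Deg≤ d (λ t → ∑ (λ i → c i ℚ.* φ i t))
  combination-deg p = Deg≤-∑ λ i → Deg≤-scale (c i) (p i)

-- Real zeros

-- `x ≈ᴿ y` unfolds to `Null` of the sequence of differences, so real equations enter below without
-- conversion. `Apart` is the positive form of having a nonzero limit.
Null Apart : (ℕ → ℚ) → Set
Null  s = ∀ ε → 0ℚ ℚ.< ε → ∃[ N ] (∀ n → N ≤ n → ℚ.∣ s n ∣ ℚ.< ε)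
Apart s = ∃[ η ] (0ℚ ℚ.< η × ∃[ N ] (∀ n → N ≤ n → η ℚ.≤ ℚ.∣ s n ∣))

*-pos : ∀ {p q} → 0ℚ ℚ.< p → 0ℚ ℚ.< q → 0ℚ ℚ.< p ℚ.* q
*-pos {p} {q} 0<p 0<q = ℚₚ.positive⁻¹ (p ℚ.* q)
  {{ℚₚ.pos*pos⇒pos p {{ℚ.positive 0<p}} q {{ℚ.positive 0<q}}}}

half-pos : ∀ {ε} → 0ℚ ℚ.< ε → 0ℚ ℚ.< ½ ℚ.* ε
half-pos = *-pos (ℚₚ.positive⁻¹ ½)

half+half : ∀ ε → ½ ℚ.* ε ℚ.+ ½ ℚ.* ε ≡ ε
half+half ε = trans (sym (ℚₚ.*-distribʳ-+ ε ½ ½)) (ℚₚ.*-identityˡ ε)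

Null-resp : ∀ {s t} → (∀ n → t n ≡ s n) → Null s → Null t
Null-resp eq h ε 0<ε with h ε 0<ε
... | N , k = N , λ n N≤n → subst (λ z → ℚ.∣ z ∣ ℚ.< ε) (sym (eq n)) (k n N≤n)

Null-+ : ∀ {s t} → Null s → Null t → Null (λ n → s n ℚ.+ t n)
Null-+ {s} {t} hs ht ε 0<ε with hs _ (half-pos 0<ε) | ht _ (half-pos 0<ε)
... | M , ks | N , kt = M ⊔ N , λ n MN≤n → begin-strict
  ℚ.∣ s n ℚ.+ t n ∣              ≤⟨ ℚₚ.∣p+q∣≤∣p∣+∣q∣ (s n) (t n) ⟩
  ℚ.∣ s n ∣ ℚ.+ ℚ.∣ t n ∣
    <⟨ ℚₚ.+-mono-< (ks n (ℕₚ.m⊔n≤o⇒m≤o M N MN≤n)) (kt n (ℕₚ.m⊔n≤o⇒n≤o M N MN≤n)) ⟩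
  ½ ℚ.* ε ℚ.+ ½ ℚ.* ε            ≡⟨ half+half ε ⟩
  ε                              ∎
  where open ℚₚ.≤-Reasoning

Null-neg : ∀ {s} → Null s → Null (λ n → ℚ.- s n)
Null-neg {s} h ε 0<ε with h ε 0<ε
... | N , k = N , λ n N≤n → subst (ℚ._< ε) (sym (ℚₚ.∣-p∣≡∣p∣ (s n))) (k n N≤n)

Null-0 : Null (λ _ → 0ℚ)
Null-0 ε 0<ε = 0 , λ _ _ → 0<ε

Null-∑ : ∀ {k} {s : Fin k → ℕ → ℚ} → (∀ i → Null (s i)) → Null (λ n → ∑ (λ i → s i n))
Null-∑ {zero}  h = Null-0
Null-∑ {suc k} h = Null-+ (h zero) (Null-∑ (h ∘ suc))

∣p∣≤∣p-q∣+∣q∣ : ∀ p q → ℚ.∣ p ∣ ℚ.≤ ℚ.∣ p ℚ.- q ∣ ℚ.+ ℚ.∣ q ∣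
∣p∣≤∣p-q∣+∣q∣ p q = subst (λ z → ℚ.∣ z ∣ ℚ.≤ ℚ.∣ p ℚ.- q ∣ ℚ.+ ℚ.∣ q ∣) (sym (back p q))
  (ℚₚ.∣p+q∣≤∣p∣+∣q∣ (p ℚ.- q) q)

bounded : ∀ {s} → IsCauchy s → ∃[ C ] (0ℚ ℚ.< C × ∃[ N ] (∀ n → N ≤ n → ℚ.∣ s n ∣ ℚ.≤ C))
bounded {s} cs with cs 1ℚ (ℚₚ.positive⁻¹ 1ℚ)
... | N , h = 1ℚ ℚ.+ ℚ.∣ s N ∣
            , ℚₚ.+-mono-<-≤ (ℚₚ.positive⁻¹ 1ℚ) (ℚₚ.0≤∣p∣ (s N))
            , N , λ n N≤n → ℚₚ.≤-trans (∣p∣≤∣p-q∣+∣q∣ (s n) (s N))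
                              (ℚₚ.+-monoˡ-≤ _ (ℚₚ.<⇒≤ (h n N N≤n ℕₚ.≤-refl)))

divide : ∀ {ε C} → 0ℚ ℚ.< ε → 0ℚ ℚ.< C → ∃[ η ] (0ℚ ℚ.< η × η ℚ.* C ≡ ε)
divide {ε} {C} 0<ε 0<C = ε ℚ.* ℚ.1/ C , *-pos 0<ε (ℚₚ.positive⁻¹ (ℚ.1/ C) {{ℚₚ.1/pos⇒pos C}}) ,
  trans (ℚₚ.*-assoc ε (ℚ.1/ C) C) (trans (cong (ε ℚ.*_) (ℚₚ.*-inverseˡ C)) (ℚₚ.*-identityʳ ε))
  where
  instance
    C-pos : ℚ.Positive C
    C-pos = ℚ.positive 0<C
    C-nonZero : ℚ.NonZero C
    C-nonZero = ℚₚ.pos⇒nonZero C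

∣*∣-< : ∀ {p q C η} → 0ℚ ℚ.< C → ℚ.∣ p ∣ ℚ.< η → ℚ.∣ q ∣ ℚ.≤ C → ℚ.∣ p ℚ.* q ∣ ℚ.< η ℚ.* C
∣*∣-< {p} {q} {C} {η} 0<C p<η q≤C = begin-strict
  ℚ.∣ p ℚ.* q ∣          ≡⟨ ℚₚ.∣p*q∣≡∣p∣*∣q∣ p q ⟩
  ℚ.∣ p ∣ ℚ.* ℚ.∣ q ∣    ≤⟨ ℚₚ.*-monoˡ-≤-nonNeg ℚ.∣ p ∣ {{ℚₚ.∣-∣-nonNeg p}} q≤C ⟩
  ℚ.∣ p ∣ ℚ.* C          <⟨ ℚₚ.*-monoˡ-<-pos C {{ℚ.positive 0<C}} p<η ⟩
  η ℚ.* C                ∎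
  where open ℚₚ.≤-Reasoning

Null-*ʳ : ∀ {s t} → Null s → IsCauchy t → Null (λ n → s n ℚ.* t n)
Null-*ʳ {s} {t} hs ct ε 0<ε =
  let C , 0<C , M , t≤C = bounded {t} ct
      η , 0<η , η*C≡ε = divide 0<ε 0<C
      N , s<η = hs η 0<η
  in M ⊔ N , λ n MN≤n → subst (ℚ.∣ s n ℚ.* t n ∣ ℚ.<_) η*C≡ε
       (∣*∣-< {s n} {t n} 0<C (s<η n (ℕₚ.m⊔n≤o⇒n≤o M N MN≤n)) (t≤C n (ℕₚ.m⊔n≤o⇒m≤o M N MN≤n)))

Null-*ˡ : ∀ {s t} → IsCauchy s → Null t → Null (λ n → s n ℚ.* t n)
Null-*ˡ {s} {t} cs ht = Null-resp (λ n → ℚₚ.*-comm (s n) (t n)) (Null-*ʳ {t} {s} ht cs)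

IsCauchy-* : ∀ {s t} → IsCauchy s → IsCauchy t → IsCauchy (λ n → s n ℚ.* t n)
IsCauchy-* {s} {t} cs ct = cauchy (mkℝ s cs *ᴿ mkℝ t ct)

IsCauchy-const : ∀ c → IsCauchy (λ _ → c)
IsCauchy-const c = cauchy (fromℚ c)

IsCauchy-∏ : ∀ {k} {s : Fin k → ℕ → ℚ} → (∀ i → IsCauchy (s i)) → IsCauchy (λ n → ∏ (λ i → s i n))
IsCauchy-∏ {zero}  cs = IsCauchy-const 1ℚ
IsCauchy-∏ {suc k} {s} cs = IsCauchy-* {s zero} (cs zero) (IsCauchy-∏ {k} {s ∘ suc} (cs ∘ suc))

Null-∏ : ∀ {k} {s : Fin k → ℕ → ℚ} → (∀ i → IsCauchy (s i)) → ∀ i → Null (s i) → Null (λ n → ∏ (λ i → s i n))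
Null-∏ {suc k} {s} cs zero    h = Null-*ʳ {s zero} h (IsCauchy-∏ {k} {s ∘ suc} (cs ∘ suc))
Null-∏ {suc k} {s} cs (suc i) h = Null-*ˡ {s zero} (cs zero) (Null-∏ {k} {s ∘ suc} (cs ∘ suc) i h)

-- Take N beyond which terms differ by less than ε/4. If the term at N is below ε/2, later terms
-- stay below ε; otherwise they stay at least ε/4, which `¬apart` excludes. No search finds an ε of
-- the second kind, hence the double negation.
¬Null⇒¬¬Apart : ∀ {s} → IsCauchy s → ¬ Null s → ¬ ¬ Apart s
¬Null⇒¬¬Apart {s} cs ¬null ¬apart = ¬null null
  where
  null : Null s
  null ε 0<ε with cs (½ ℚ.* (½ ℚ.* ε)) (half-pos (half-pos 0<ε))
  ... | N , close with ℚ.∣ s N ∣ ℚₚ.<? ½ ℚ.* ε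
  ...   | yes small = N , λ n N≤n → begin-strict
    ℚ.∣ s n ∣                                ≤⟨ ∣p∣≤∣p-q∣+∣q∣ (s n) (s N) ⟩
    ℚ.∣ s n ℚ.- s N ∣ ℚ.+ ℚ.∣ s N ∣          <⟨ ℚₚ.+-mono-< (close n N N≤n ℕₚ.≤-refl) small ⟩
    ½ ℚ.* (½ ℚ.* ε) ℚ.+ ½ ℚ.* ε              ≤⟨ ℚₚ.+-monoˡ-≤ (½ ℚ.* ε) quarter≤half ⟩
    ½ ℚ.* ε ℚ.+ ½ ℚ.* ε                      ≡⟨ half+half ε ⟩
    ε                                        ∎
    where
    open ℚₚ.≤-Reasoning
    quarter≤half : ½ ℚ.* (½ ℚ.* ε) ℚ.≤ ½ ℚ.* ε
    quarter≤half = begin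
      ½ ℚ.* (½ ℚ.* ε)                        ≡⟨ ℚₚ.+-identityʳ _ ⟨
      ½ ℚ.* (½ ℚ.* ε) ℚ.+ 0ℚ
        ≤⟨ ℚₚ.+-monoʳ-≤ (½ ℚ.* (½ ℚ.* ε)) (ℚₚ.<⇒≤ (half-pos (half-pos 0<ε))) ⟩
      ½ ℚ.* (½ ℚ.* ε) ℚ.+ ½ ℚ.* (½ ℚ.* ε)    ≡⟨ half+half (½ ℚ.* ε) ⟩
      ½ ℚ.* ε                                ∎
  ...   | no  large = contradiction
    (½ ℚ.* (½ ℚ.* ε) , half-pos (half-pos 0<ε) , N , λ n N≤n → away n N≤n) ¬apart
    where
    open ℚₚ.≤-Reasoning
    q : ℚ
    q = ½ ℚ.* (½ ℚ.* ε)
    away : ∀ n → N ≤ n → q ℚ.≤ ℚ.∣ s n ∣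
    away n N≤n = ℚₚ.≮⇒≥ λ near → ℚₚ.<-irrefl refl (ℚₚ.<-≤-trans (ℚₚ.+-monoʳ-< q near) (begin
      q ℚ.+ q                            ≡⟨ half+half (½ ℚ.* ε) ⟩
      ½ ℚ.* ε                            ≤⟨ ℚₚ.≮⇒≥ large ⟩
      ℚ.∣ s N ∣                          ≤⟨ ∣p∣≤∣p-q∣+∣q∣ (s N) (s n) ⟩
      ℚ.∣ s N ℚ.- s n ∣ ℚ.+ ℚ.∣ s n ∣    ≤⟨ ℚₚ.+-monoˡ-≤ _ (ℚₚ.<⇒≤ (close N n ℕₚ.≤-refl N≤n)) ⟩
      q ℚ.+ ℚ.∣ s n ∣                    ∎))

Apart⇒¬Null : ∀ {s} → Apart s → ¬ Null s
Apart⇒¬Null (η , 0<η , M , far) null with null η 0<η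
... | N , near = ℚₚ.<-irrefl refl (ℚₚ.<-≤-trans (near (M ⊔ N) (ℕₚ.m≤n⊔m M N)) (far (M ⊔ N) (ℕₚ.m≤m⊔n M N)))

Apart-const : ∀ {c} → c ≢ 0ℚ → Apart (λ _ → c)
Apart-const {c} c≢0 = ℚ.∣ c ∣
  , ℚₚ.≰⇒> (λ ∣c∣≤0 → c≢0 (ℚₚ.∣p∣≡0⇒p≡0 c (ℚₚ.≤-antisym ∣c∣≤0 (ℚₚ.0≤∣p∣ c))))
  , 0 , λ _ _ → ℚₚ.≤-refl

Apart-* : ∀ {s t} → Apart s → Apart t → Apart (λ n → s n ℚ.* t n)
Apart-* {s} {t} (η , 0<η , M , hs) (θ , 0<θ , N , ht) = η ℚ.* θ , *-pos 0<η 0<θ , M ⊔ N , λ n MN≤n → begin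
  η ℚ.* θ
    ≤⟨ ℚₚ.*-monoʳ-≤-nonNeg θ {{ℚ.nonNegative (ℚₚ.<⇒≤ 0<θ)}} (hs n (ℕₚ.m⊔n≤o⇒m≤o M N MN≤n)) ⟩
  ℚ.∣ s n ∣ ℚ.* θ
    ≤⟨ ℚₚ.*-monoˡ-≤-nonNeg ℚ.∣ s n ∣ {{ℚₚ.∣-∣-nonNeg (s n)}} (ht n (ℕₚ.m⊔n≤o⇒n≤o M N MN≤n)) ⟩
  ℚ.∣ s n ∣ ℚ.* ℚ.∣ t n ∣    ≡⟨ ℚₚ.∣p*q∣≡∣p∣*∣q∣ (s n) (t n) ⟨
  ℚ.∣ s n ℚ.* t n ∣          ∎
  where open ℚₚ.≤-Reasoning

¬¬Apart-∏ : ∀ {k} {s : Fin k → ℕ → ℚ} → (∀ i → ¬ ¬ Apart (s i)) → ¬ ¬ Apart (λ n → ∏ (λ i → s i n))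
¬¬Apart-∏ {zero}  h k = k (Apart-const {1ℚ} λ ())
¬¬Apart-∏ {suc m} {s} h k = h zero λ a → ¬¬Apart-∏ (h ∘ suc) λ b → k (Apart-* {s zero} a b)

module RealConfiguration {n K} (x y : Fin n → ℝ) (a b : Fin K → ℝ) where

  incidenceᴿ : Fin n → Fin n → Fin K → ℝ
  incidenceᴿ v w j = a j *ᴿ (y w -ᴿ y v) -ᴿ b j *ᴿ (x w -ᴿ x v)

  approximation : ℕ → Configuration n K
  approximation m = config (tabulate λ v → seq (x v) m) (tabulate λ v → seq (y v) m)
                           (tabulate λ j → seq (a j) m) (tabulate λ j → seq (b j) m)

  pairFactor : (Fin n → Fin n → Bool) → Fin n → Fin n → ℕ → ℚ
  pairFactor B v w m = if B v w then ∏ (λ j → seq (incidenceᴿ v w j) m) else 1ℚ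

  value : (Fin n → Fin n → Bool) → ℕ → ℚ
  value B m = ∏ λ v → ∏ λ w → pairFactor B v w m

  graphPolynomial-approximation : ∀ B m → graphPolynomial B (approximation m) ≡ value B m
  graphPolynomial-approximation B m = ∏ℚ.sum-cong-≗ λ v → ∏ℚ.sum-cong-≗ λ w →
    cong (λ z → if B v w then z else 1ℚ) (∏ℚ.sum-cong-≗ λ j → cong₂ ℚ._-_
      (cong₂ ℚ._*_ (lookup∘tabulate (λ j → seq (a j) m) j)
        (cong₂ ℚ._-_ (lookup∘tabulate (λ v → seq (y v) m) w) (lookup∘tabulate (λ v → seq (y v) m) v)))
      (cong₂ ℚ._*_ (lookup∘tabulate (λ j → seq (b j) m) j)
        (cong₂ ℚ._-_ (lookup∘tabulate (λ v → seq (x v) m) w) (lookup∘tabulate (λ v → seq (x v) m) v))))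

  pairFactor-cauchy : ∀ B v w → IsCauchy (pairFactor B v w)
  pairFactor-cauchy B v w with B v w
  ... | true  = IsCauchy-∏ {K} {λ j → seq (incidenceᴿ v w j)} (λ j → cauchy (incidenceᴿ v w j))
  ... | false = IsCauchy-const 1ℚ

  value-null : ∀ B v w j → B v w ≡ true → Null (seq (incidenceᴿ v w j)) → Null (value B)
  value-null B v w j Bvw null = Null-∏ {n} {λ v m → ∏ λ w → pairFactor B v w m}
    (λ v → IsCauchy-∏ {n} {pairFactor B v} (pairFactor-cauchy B v)) v
    (Null-∏ {n} {pairFactor B v} (pairFactor-cauchy B v) w pair-null)
    where
    pair-null : Null (pairFactor B v w)
    pair-null rewrite Bvw = Null-∏ {K} {λ j → seq (incidenceᴿ v w j)} (λ j → cauchy (incidenceᴿ v w j)) j null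

  value-apart : ∀ B → (∀ v w → B v w ≡ true → ∀ j → ¬ Null (seq (incidenceᴿ v w j))) → ¬ ¬ Apart (value B)
  value-apart B h = ¬¬Apart-∏ λ v → ¬¬Apart-∏ λ w → pair-apart v w
    where
    pair-apart : ∀ v w → ¬ ¬ Apart (pairFactor B v w)
    pair-apart v w with B v w in eq
    ... | true  = ¬¬Apart-∏ λ j → ¬Null⇒¬¬Apart (cauchy (incidenceᴿ v w j)) (h v w eq j)
    ... | false = λ k → k (Apart-const {1ℚ} λ ())

  -- In the limit every term except that of i₀ tends to 0, so by the identity that term does too,
  -- although it stays away from 0. The goal is a negation, so apartness up to ¬¬ is enough.
  no-dependence : ∀ {M} (B : Fin M → Fin n → Fin n → Bool) c i₀ → c i₀ ≢ 0ℚ →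
    (∀ (z : Configuration n K) → combination c (graphPolynomial ∘ B) z ≡ 0ℚ) →
    (∀ v w → B i₀ v w ≡ true → ∀ j → ¬ Null (seq (incidenceᴿ v w j))) →
    ¬ (∀ i → i ≢ i₀ → ∃[ v ] ∃[ w ] ∃[ j ] (B i v w ≡ true × Null (seq (incidenceᴿ v w j))))
  no-dependence {suc M} B c i₀ c≢0 zeros nonzero vanish =
    value-apart (B i₀) nonzero λ apart →
      Apart⇒¬Null (Apart-* (Apart-const c≢0) apart)
        (Null-resp isolate (Null-neg (Null-∑ others)))
    where
    term : Fin (suc M) → ℕ → ℚ
    term i m = c i ℚ.* value (B i) m

    others : ∀ i → Null (term (punchIn i₀ i))
    others i with vanish (punchIn i₀ i) (punchInᵢ≢i i₀ i)
    ... | v , w , j , Bvw , null = Null-*ˡ {λ _ → c (punchIn i₀ i)} (IsCauchy-const (c (punchIn i₀ i)))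
      (value-null (B (punchIn i₀ i)) v w j Bvw null)

    isolate : ∀ m → term i₀ m ≡ ℚ.- ∑ (λ i → term (punchIn i₀ i) m)
    isolate m = begin
      term i₀ m
        ≡⟨ solve 2 (λ p q → p := (p :+ q) :- q) refl (term i₀ m) rest ⟩
      (term i₀ m ℚ.+ rest) ℚ.- rest
        ≡⟨ cong (ℚ._- rest) (∑ℚ.sum-remove {i = i₀} (λ i → term i m)) ⟨
      ∑ (λ i → term i m) ℚ.- rest
        ≡⟨ cong (ℚ._- rest) (∑ℚ.sum-cong-≗ λ i → cong (c i ℚ.*_) (graphPolynomial-approximation (B i) m)) ⟨
      combination c (graphPolynomial ∘ B) (approximation m) ℚ.- rest
                                         ≡⟨ cong (ℚ._- rest) (zeros (approximation m)) ⟩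
      0ℚ ℚ.- rest                        ≡⟨ ℚₚ.+-identityˡ (ℚ.- rest) ⟩
      ℚ.- rest                           ∎
      where
      open ≡-Reasoning
      open +-*-Solver
      rest : ℚ
      rest = ∑ (λ i → term (punchIn i₀ i) m)

-- Slopes as zeros of incidences

abscissa ordinate : Slope → ℝ
abscissa nothing  = fromℚ 0ℚ
abscissa (just s) = fromℚ 1ℚ
ordinate nothing  = fromℚ 1ℚ
ordinate (just s) = s

slopeIncidence : Point → Point → Slope → ℝ
slopeIncidence (x , y) (x′ , y′) σ = abscissa σ *ᴿ (y′ -ᴿ y) -ᴿ ordinate σ *ᴿ (x′ -ᴿ x)

vertical-incidence : ∀ x y x′ y′ → incidence 0ℚ 1ℚ x y x′ y′ ≡ x ℚ.- x′
vertical-incidence = solve 4 (λ x y x′ y′ →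
  con 0ℚ :* (y′ :- y) :- con 1ℚ :* (x′ :- x) := x :- x′) refl
  where open +-*-Solver

finite-incidence : ∀ s x y x′ y′ → incidence 1ℚ s x y x′ y′ ≡ ℚ.- (s ℚ.* (x′ ℚ.- x) ℚ.- (y′ ℚ.- y))
finite-incidence = solve 5 (λ s x y x′ y′ →
  con 1ℚ :* (y′ :- y) :- s :* (x′ :- x) := :- (s :* (x′ :- x) :- (y′ :- y))) refl
  where open +-*-Solver

hasSlope⇒null : ∀ {p q σ} → HasSlope p q σ → Null (seq (slopeIncidence p q σ))
hasSlope⇒null (vertical {x} {y} {x′} {y′} x≈x′) =
  Null-resp (λ n → vertical-incidence (seq x n) (seq y n) (seq x′ n) (seq y′ n)) x≈x′
hasSlope⇒null (finite {x} {y} {x′} {y′} {s} _ e) =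
  Null-resp (λ n → finite-incidence (seq s n) (seq x n) (seq y n) (seq x′ n) (seq y′ n))
    (Null-neg {λ n → seq s n ℚ.* (seq x′ n ℚ.- seq x n) ℚ.- (seq y′ n ℚ.- seq y n)} e)

-- For a finite slope, equal abscissas and a null incidence would force equal ordinates;
-- distinctness of the points therefore supplies the inequality that `finite` demands.
null⇒hasSlope : ∀ p q σ → ¬ (p ≈ᴾ q) → Null (seq (slopeIncidence p q σ)) → HasSlope p q σ
null⇒hasSlope (x , y) (x′ , y′) nothing p≉q null = vertical
  (Null-resp (λ n → sym (vertical-incidence (seq x n) (seq y n) (seq x′ n) (seq y′ n))) null)
null⇒hasSlope (x , y) (x′ , y′) (just s) p≉q null = finite x≉x′
  (Null-resp (λ n → trans (sym (neg-neg (d n))) (cong ℚ.-_ (sym (i≡ n)))) (Null-neg {i} null))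
  where
  i d : ℕ → ℚ
  i = seq (slopeIncidence (x , y) (x′ , y′) (just s))
  d n = seq s n ℚ.* (seq x′ n ℚ.- seq x n) ℚ.- (seq y′ n ℚ.- seq y n)
  i≡ : ∀ n → i n ≡ ℚ.- d n
  i≡ n = finite-incidence (seq s n) (seq x n) (seq y n) (seq x′ n) (seq y′ n)
  neg-neg : ∀ p → ℚ.- (ℚ.- p) ≡ p
  neg-neg = solve 1 (λ p → :- (:- p) := p) refl
    where open +-*-Solver
  ordinates : ∀ s x y x′ y′ → y ℚ.- y′ ≡ ℚ.- incidence 1ℚ s x y x′ y′ ℚ.+ s ℚ.* (x ℚ.- x′)
  ordinates = solve 5 (λ s x y x′ y′ →
    y :- y′ := :- (con 1ℚ :* (y′ :- y) :- s :* (x′ :- x)) :+ s :* (x :- x′)) refl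
    where open +-*-Solver
  x≉x′ : ¬ (x ≈ᴿ x′)
  x≉x′ x≈x′ = p≉q (x≈x′ , Null-resp
    (λ n → ordinates (seq s n) (seq x n) (seq y n) (seq x′ n) (seq y′ n))
    (Null-+ {λ n → ℚ.- i n} (Null-neg {i} null)
      (Null-*ˡ {seq s} {λ n → seq x n ℚ.- seq x′ n} (cauchy s) x≈x′)))

does⇒ : ∀ {P : Set} (d : Dec P) → does d ≡ true → P
does⇒ (yes p) _ = p

-- The diagonal is excluded because the incidence of a point with itself is identically 0.
nonEdge : ∀ {n} (G : Graph n) → Decidable (Adj G) → Fin n → Fin n → Bool
nonEdge G dec v w = does (¬? (v Finₚ.≟ w) ×-dec ¬? (dec v w))

-- Repeating slopes turns a realisation with k slopes into one with K slots.
extend : ∀ {k K} → 1 ≤ k → k ≤ K → Σ[ r ∈ (Fin K → Fin k) ] (∀ j → ∃[ i ] r i ≡ j)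
extend {suc k} _ k≤K with ℕₚ.m≤n⇒∃[o]m+o≡n k≤K
... | e , refl = [ id , const zero ] ∘ splitAt (suc k)
               , λ j → j ↑ˡ e , cong [ id , const zero ] (splitAt-↑ˡ (suc k) j e)

-- The index comes from the dependence before k and the realisation are given, so one graph fails
-- for all k up to K at once. The isomorphism is absorbed by pulling the points back to `pt`.
unrealisable-member : ∀ {n K M} (G : Fin M → Graph n) (dec : ∀ i → Decidable (Adj (G i))) →
  (∀ i i′ → i ≢ i′ → ∃[ v ] ∃[ w ] (Adj (G i) v w × ¬ Adj (G i′) v w)) →
  gridSize n K < M →
  ∃[ i ] (∀ k → 1 ≤ k → k ≤ K → ¬ RealisableWith (G i) k)
unrealisable-member {n} {K} {M} G dec separated size<M
  with graphPolynomial-dependence {n} {K} (λ i → nonEdge (G i) (dec i)) size<M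
... | c , (i₀ , c≢0) , zeros = i₀ , λ k 1≤k k≤K (m , (p , p-inj) , (s , _) , φ , iso) →
  let r , r-onto = extend 1≤k k≤K
      pt = λ v → p (Inverse.to φ v)
      to-inj : ∀ {v w} → Inverse.to φ v ≡ Inverse.to φ w → v ≡ w
      to-inj = λ {v} {w} eq → trans (sym (Inverse.strictlyInverseʳ φ v))
        (trans (cong (Inverse.from φ) eq) (Inverse.strictlyInverseʳ φ w))
  in RealConfiguration.no-dependence {n} {K} (proj₁ ∘ pt) (proj₂ ∘ pt) (abscissa ∘ s ∘ r) (ordinate ∘ s ∘ r)
       (λ i → nonEdge (G i) (dec i)) c i₀ c≢0 zeros
       (λ v w Bvw j null →
         let v≢w , ¬adj = does⇒ (¬? (v Finₚ.≟ w) ×-dec ¬? (dec i₀ v w)) Bvw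
         in ¬adj (Equivalence.from (iso v w)
              ( (λ eq → v≢w (to-inj eq)) , r j
              , null⇒hasSlope (pt v) (pt w) (s (r j)) (λ eq → v≢w (to-inj (p-inj eq))) null)))
       (λ i i≢i₀ →
         let v , w , adj , ¬adj = separated i₀ i (i≢i₀ ∘ sym)
             _ , l , slope = Equivalence.to (iso v w) adj
             j , rj≡l = r-onto l
         in v , w , j
            , dec-true (¬? (v Finₚ.≟ w) ×-dec ¬? (dec i v w))
                ((λ v≡w → irrefl (G i₀) v (subst (Adj (G i₀) v) (sym v≡w) adj)) , ¬adj)
            , hasSlope⇒null (subst (λ l → HasSlope (pt v) (pt w) (s l)) (sym rj≡l) slope))

-- A large family of regular graphs

∣p[x]≔inside∣ : ∀ {n} (p : Subset n) x → x Subset.∉ p → Subset.∣ p [ x ]≔ inside ∣ ≡ suc Subset.∣ p ∣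
∣p[x]≔inside∣ (inside  ∷ p) zero    x∉p = contradiction here x∉p
∣p[x]≔inside∣ (outside ∷ p) zero    x∉p = refl
∣p[x]≔inside∣ (inside  ∷ p) (suc x) x∉p = cong suc (∣p[x]≔inside∣ p x (x∉p ∘ there))
∣p[x]≔inside∣ (outside ∷ p) (suc x) x∉p = ∣p[x]≔inside∣ p x (x∉p ∘ there)

image : ∀ {d n} → (Fin d → Fin n) → Subset n
image {zero}  f = ⊥
image {suc d} f = image (f ∘ suc) [ f zero ]≔ inside

∈-image⁺ : ∀ {d n} (f : Fin d → Fin n) j → f j Subset.∈ image f
∈-image⁺ f zero    = []≔-updates (image (f ∘ suc)) (f zero)
∈-image⁺ f (suc j) with f (suc j) Finₚ.≟ f zero
... | yes eq rewrite eq = []≔-updates (image (f ∘ suc)) (f zero)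
... | no  ne = []≔-minimal (image (f ∘ suc)) (f (suc j)) (f zero) ne (∈-image⁺ (f ∘ suc) j)

∈-image⁻ : ∀ {d n} (f : Fin d → Fin n) w → w Subset.∈ image f → ∃[ j ] f j ≡ w
∈-image⁻ {zero}  f w w∈ = contradiction w∈ ∉⊥
∈-image⁻ {suc d} f w w∈ with w Finₚ.≟ f zero
... | yes eq = zero , sym eq
... | no  ne with ∈-image⁻ (f ∘ suc) w (lookup⇒[]= w (image (f ∘ suc))
                    (trans (sym (lookup∘update′ ne (image (f ∘ suc)) inside)) ([]=⇒lookup w∈)))
...   | j , eq = suc j , eq

∣image∣ : ∀ {d n} (f : Fin d → Fin n) → Injective _≡_ _≡_ f → Subset.∣ image f ∣ ≡ d
∣image∣ {zero}  {n} f inj = ∣⊥∣≡0 n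
∣image∣ {suc d} f inj = trans
  (∣p[x]≔inside∣ (image (f ∘ suc)) (f zero) λ f0∈ →
    case ∈-image⁻ (f ∘ suc) (f zero) f0∈ of λ (j , eq) → case inj eq of λ ())
  (cong suc (∣image∣ (f ∘ suc) (Finₚ.suc-injective ∘ inj)))

-- Numbered neighbour lists make adjacency decidable and reduce regularity to injectivity.
record Neighbours (V : Set) (d : ℕ) : Set where
  field
    nbr      : V → Fin d → V
    mutual-nbr : ∀ u j → ∃[ k ] nbr (nbr u j) k ≡ u
    nbr-inj  : ∀ u → Injective _≡_ _≡_ (nbr u)
    nbr-≢    : ∀ u j → nbr u j ≢ u

module NeighbourGraph {V : Set} {n d} (e : Fin n ↔ V) (N : Neighbours V d) where
  open Neighbours N
  open Inverse e using (to; from; strictlyInverseˡ; strictlyInverseʳ)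

  neighbour : Fin n → Fin d → Fin n
  neighbour v j = from (nbr (to v) j)

  graph : Graph n
  graph = record
    { Adj    = λ v w → ∃[ j ] neighbour v j ≡ w
    ; symm   = λ { {v} (j , refl) → let k , eq = mutual-nbr (to v) j in
        k , trans (cong (λ u → from (nbr u k)) (strictlyInverseˡ (nbr (to v) j)))
              (trans (cong from eq) (strictlyInverseʳ v)) }
    ; irrefl = λ v (j , eq) → nbr-≢ (to v) j (trans (sym (strictlyInverseˡ _)) (cong to eq))
    }

  adj? : Decidable (Adj graph)
  adj? v w = any? λ j → neighbour v j Finₚ.≟ w

  regular : Regular d graph
  regular v = image (neighbour v)
    , (λ w → mk⇔ (∈-image⁻ (neighbour v) w) λ { (j , refl) → ∈-image⁺ (neighbour v) j })
    , ∣image∣ (neighbour v) λ {i} {j} eq → nbr-inj (to v)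
        (trans (sym (strictlyInverseˡ _)) (trans (cong to eq) (strictlyInverseˡ _)))

  adj-to : ∀ u w → (∃[ j ] nbr u j ≡ w) ⇔ Adj graph (from u) (from w)
  adj-to u w = mk⇔
    (λ { (j , refl) → j , cong (λ u → from (nbr u j)) (strictlyInverseˡ u) })
    (λ (j , eq) → j , trans (cong (λ u → nbr u j) (sym (strictlyInverseˡ u)))
      (trans (sym (strictlyInverseˡ _)) (trans (cong to eq) (strictlyInverseˡ w))))

-- Left block a and right block b are joined by the perfect matching `π a b`, so a block vertex has
-- one neighbour in each of the Δ opposite blocks. Separate blocks keep the matchings disjoint
-- whatever the permutations are; the cliques only fill up the order.
module Family (Δ t c : ℕ) where

  Vertex : Set
  Vertex = (Fin Δ × Fin t) ⊎ (Fin Δ × Fin t) ⊎ (Fin c × Fin (suc Δ))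

  order : ℕ
  order = Δ * t + (Δ * t + c * suc Δ)

  vertices : Fin order ↔ Vertex
  vertices = (Finₚ.*↔× ⊎-↔ ((Finₚ.*↔× ⊎-↔ Finₚ.*↔×) ↔-∘ Finₚ.+↔⊎)) ↔-∘ Finₚ.+↔⊎

  pattern left a i  = inj₁ (a , i)
  pattern right b i = inj₂ (inj₁ (b , i))
  pattern clique k i = inj₂ (inj₂ (k , i))

  neighbours : (Fin Δ → Fin Δ → Permutation t t) → Neighbours Vertex Δ
  neighbours π = record
    { nbr = nbr
    ; mutual-nbr = mutual-nbr
    ; nbr-inj = nbr-inj
    ; nbr-≢ = nbr-≢
    }
    where
    nbr : Vertex → Fin Δ → Vertex
    nbr (left a i)   b = right b (π a b ⟨$⟩ʳ i)
    nbr (right b i)  a = left a (π a b ⟨$⟩ˡ i)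
    nbr (clique k i) j = clique k (punchIn i j)

    mutual-nbr : ∀ u j → ∃[ k ] nbr (nbr u j) k ≡ u
    mutual-nbr (left a i)   b = a , cong (λ i → left a i) (Permutation.inverseˡ (π a b))
    mutual-nbr (right b i)  a = b , cong (λ i → right b i) (Permutation.inverseʳ (π a b))
    mutual-nbr (clique k i) j = Fin.punchOut (punchInᵢ≢i i j)
      , cong (λ i → clique k i) (Finₚ.punchIn-punchOut (punchInᵢ≢i i j))

    nbr-inj : ∀ u → Injective _≡_ _≡_ (nbr u)
    nbr-inj (left a i)   eq = ,-injectiveˡ (inj₁-injective (inj₂-injective eq))
    nbr-inj (right b i)  eq = ,-injectiveˡ (inj₁-injective eq)
    nbr-inj (clique k i) {j} {j′} eq =
      Finₚ.punchIn-injective i j j′ (,-injectiveʳ (inj₂-injective (inj₂-injective eq)))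

    nbr-≢ : ∀ u j → nbr u j ≢ u
    nbr-≢ (left a i)   b ()
    nbr-≢ (right b i)  a ()
    nbr-≢ (clique k i) j eq = punchInᵢ≢i i j (,-injectiveʳ (inj₂-injective (inj₂-injective eq)))

  blockGraph : (Fin Δ → Fin Δ → Permutation t t) → Graph order
  blockGraph π = NeighbourGraph.graph vertices (neighbours π)

  -- A left vertex has exactly one neighbour in right block b, so where the permutations differ the
  -- edge of one graph is missing in the other.
  blockGraph-separated : ∀ π ρ a b i → π a b ⟨$⟩ʳ i ≢ ρ a b ⟨$⟩ʳ i →
    ∃[ v ] ∃[ w ] (Adj (blockGraph π) v w × ¬ Adj (blockGraph ρ) v w)
  blockGraph-separated π ρ a b i ne = _ , _
    , Equivalence.to (NeighbourGraph.adj-to vertices (neighbours π) (left a i) (right b (π a b ⟨$⟩ʳ i))) (b , refl)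
    , λ adj → case Equivalence.from (NeighbourGraph.adj-to vertices (neighbours ρ) (left a i) (right b (π a b ⟨$⟩ʳ i))) adj of
        λ { (b′ , eq) → ne (aux b′ (inj₁-injective (inj₂-injective eq))) }
    where
    aux : ∀ b′ → (b′ , ρ a b′ ⟨$⟩ʳ i) ≡ (b , π a b ⟨$⟩ʳ i) → π a b ⟨$⟩ʳ i ≡ ρ a b ⟨$⟩ʳ i
    aux b′ eq with ,-injectiveˡ eq
    ... | refl = sym (,-injectiveʳ eq)

funToFin-cong : ∀ {m n} {f g : Fin m → Fin n} → (∀ i → f i ≡ g i) → funToFin f ≡ funToFin g
funToFin-cong {zero}  eq = refl
funToFin-cong {suc m} eq = cong₂ combine (eq zero) (funToFin-cong (eq ∘ suc))

finToFun-injective : ∀ {m n} (x y : Fin (m ^ n)) → (∀ i → finToFun {m} {n} x i ≡ finToFun y i) → x ≡ y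
finToFun-injective {m} {n} x y eq = trans (sym (Finₚ.funToFin-finToFin {n} {m} x))
  (trans (funToFin-cong eq) (Finₚ.funToFin-finToFin {n} {m} y))

-- Lehmer code: the leading digit is the image of 0, the remainder encodes the permutation of the
-- rest.
nthPermutation : ∀ t → Fin (t !) → Permutation t t
nthPermutation zero    _ = Permutation.id
nthPermutation (suc t) x =
  let q , r = remQuot {suc t} (t !) x in Permutation.insert zero q (nthPermutation t r)

nthPermutation-injective : ∀ t x y →
  (∀ i → nthPermutation t x ⟨$⟩ʳ i ≡ nthPermutation t y ⟨$⟩ʳ i) → x ≡ y
nthPermutation-injective zero    zero zero _ = refl
nthPermutation-injective (suc t) x y eq = begin
  x                                        ≡⟨ Finₚ.combine-remQuot {suc t} (t !) x ⟨
  uncurry combine (remQuot {suc t} (t !) x)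
    ≡⟨ cong₂ combine (eq zero) (nthPermutation-injective t _ _ rest) ⟩
  uncurry combine (remQuot {suc t} (t !) y) ≡⟨ Finₚ.combine-remQuot {suc t} (t !) y ⟩
  y                                        ∎
  where
  open ≡-Reasoning
  qx qy : Fin (suc t)
  qx = proj₁ (remQuot {suc t} (t !) x)
  qy = proj₁ (remQuot {suc t} (t !) y)
  rx ry : Fin (t !)
  rx = proj₂ (remQuot {suc t} (t !) x)
  ry = proj₂ (remQuot {suc t} (t !) y)
  rest : ∀ i → nthPermutation t rx ⟨$⟩ʳ i ≡ nthPermutation t ry ⟨$⟩ʳ i
  rest i = Finₚ.punchIn-injective qx _ _ (begin
    punchIn qx (nthPermutation t rx ⟨$⟩ʳ i)
      ≡⟨ Permutation.insert-punchIn zero qx (nthPermutation t rx) i ⟨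
    nthPermutation (suc t) x ⟨$⟩ʳ suc i      ≡⟨ eq (suc i) ⟩
    nthPermutation (suc t) y ⟨$⟩ʳ suc i
      ≡⟨ Permutation.insert-punchIn zero qy (nthPermutation t ry) i ⟩
    punchIn qy (nthPermutation t ry ⟨$⟩ʳ i)
      ≡⟨ cong (λ q → punchIn q (nthPermutation t ry ⟨$⟩ʳ i)) (eq zero) ⟨
    punchIn qx (nthPermutation t ry ⟨$⟩ʳ i)  ∎)

permutations : ∀ Δ t → Fin (((t !) ^ Δ) ^ Δ) → Fin Δ → Fin Δ → Permutation t t
permutations Δ t x a b = nthPermutation t (finToFun (finToFun {(t !) ^ Δ} {Δ} x a) b)

permutations-differ : ∀ Δ t x y → x ≢ y →
  ∃[ a ] ∃[ b ] ∃[ i ] permutations Δ t x a b ⟨$⟩ʳ i ≢ permutations Δ t y a b ⟨$⟩ʳ i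
permutations-differ Δ t x y x≢y =
  let a , na = Finₚ.¬∀⟶∃¬ Δ _ (λ a → finToFun {(t !) ^ Δ} {Δ} x a Finₚ.≟ finToFun y a) (x≢y ∘ finToFun-injective x y)
      b , nb = Finₚ.¬∀⟶∃¬ Δ _ (λ b → finToFun {t !} {Δ} _ b Finₚ.≟ finToFun _ b) (na ∘ finToFun-injective _ _)
      i , ni = Finₚ.¬∀⟶∃¬ t _ (λ i → permutations Δ t x a b ⟨$⟩ʳ i Finₚ.≟ permutations Δ t y a b ⟨$⟩ʳ i)
                 (nb ∘ nthPermutation-injective t _ _)
  in a , b , i , ni

-- Every finite graph is a slope graph

¬¬least : ∀ (P : ℕ → Set) k → P k → ¬ ¬ (∃[ k ] (P k × (∀ j → P j → k ≤ j)))
¬¬least P k Pk none = <-rec (λ k → ¬ P k)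
  (λ k below Pk → none (k , Pk , λ j Pj → ℕₚ.≮⇒≥ λ j<k → below j<k Pj)) k Pk

Null-const : ∀ {c} → Null (λ _ → c) → c ≡ 0ℚ
Null-const {c} null = decidable-stable (c ℚₚ.≟ 0ℚ) λ c≢0 → Apart⇒¬Null (Apart-const c≢0) null

node-injective : ∀ {i j} → node i ≡ node j → i ≡ j
node-injective {i} {j} eq with ℕₚ.<-cmp i j
... | tri< i<j _ _ = contradiction eq (ℚₚ.<⇒≢ (node-mono i<j))
... | tri≈ _ i≡j _ = i≡j
... | tri> _ _ j<i = contradiction (sym eq) (ℚₚ.<⇒≢ (node-mono j<i))

node-+ : ∀ i j → node (i + j) ≡ node i ℚ.+ node j
node-+ zero    j = sym (ℚₚ.+-identityˡ (node j))
node-+ (suc i) j = trans (cong (1ℚ ℚ.+_) (node-+ i j)) (sym (ℚₚ.+-assoc 1ℚ (node i) (node j)))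

2^-mono-< : ∀ {i j} → i < j → 2 ^ i < 2 ^ j
2^-mono-< = ℕₚ.^-monoʳ-< 2 (s≤s (s≤s z≤n))

2^-injective : ∀ {i j} → 2 ^ i ≡ 2 ^ j → i ≡ j
2^-injective {i} {j} eq with ℕₚ.<-cmp i j
... | tri< i<j _ _ = contradiction eq (ℕₚ.<⇒≢ (2^-mono-< i<j))
... | tri≈ _ i≡j _ = i≡j
... | tri> _ _ j<i = contradiction (sym eq) (ℕₚ.<⇒≢ (2^-mono-< j<i))

2^+2^-top : ∀ {i j k l} → i < j → 2 ^ i + 2 ^ j ≡ 2 ^ k + 2 ^ l → ¬ (j < l)
2^+2^-top {i} {j} {k} {l} i<j eq j<l = ℕₚ.<-irrefl eq (begin-strict
  2 ^ i + 2 ^ j    <⟨ ℕₚ.+-monoˡ-< (2 ^ j) (2^-mono-< i<j) ⟩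
  2 ^ j + 2 ^ j    ≡⟨ cong (λ z → 2 ^ j + z) (ℕₚ.+-identityʳ (2 ^ j)) ⟨
  2 ^ suc j        ≤⟨ ℕₚ.^-monoʳ-≤ 2 j<l ⟩
  2 ^ l            ≤⟨ ℕₚ.m≤n+m (2 ^ l) (2 ^ k) ⟩
  2 ^ k + 2 ^ l    ∎)
  where open ℕₚ.≤-Reasoning

-- Uniqueness of binary expansions: the top exponents agree because 2^i + 2^j < 2^(j+1), and then
-- the top terms cancel.
2^+2^-injective : ∀ {i j k l} → i < j → k < l → 2 ^ i + 2 ^ j ≡ 2 ^ k + 2 ^ l → i ≡ k × j ≡ l
2^+2^-injective {i} {j} {k} {l} i<j k<l eq with ℕₚ.<-cmp j l
... | tri< j<l _ _ = contradiction j<l (2^+2^-top {k = k} i<j eq)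
... | tri> _ _ l<j = contradiction l<j (2^+2^-top {k = i} k<l (sym eq))
... | tri≈ _ refl _ = 2^-injective (ℕₚ.+-cancelʳ-≡ (2 ^ j) (2 ^ i) (2 ^ k) eq) , refl

lookup-injective : ∀ {A : Set} {xs : List A} → Unique xs → Injective _≡_ _≡_ (List.lookup xs)
lookup-injective (_  ∷ _) {zero}  {zero}  _  = refl
lookup-injective (x∉ ∷ _) {zero}  {suc j} eq = contradiction eq (All.lookup x∉ (∈-lookup j))
lookup-injective (x∉ ∷ _) {suc i} {zero}  eq = contradiction (sym eq) (All.lookup x∉ (∈-lookup i))
lookup-injective (_  ∷ u) {suc i} {suc j} eq = cong suc (lookup-injective u eq)

-- The points lie on a parabola, where the chord over x and x′ has slope x + x′;
-- abscissas 2 ^ v make these sums distinct.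
module Parabola {n} (G : Graph n) (adj? : Decidable (Adj G)) where

  abs : Fin n → ℚ
  abs v = node (2 ^ toℕ v)

  abs-injective : ∀ {v w} → abs v ≡ abs w → v ≡ w
  abs-injective eq = Finₚ.toℕ-injective (2^-injective (node-injective eq))

  point : Fin n → Point
  point v = fromℚ (abs v) , fromℚ (abs v ℚ.* abs v)

  fromℚ-injective : ∀ {p q} → fromℚ p ≈ᴿ fromℚ q → p ≡ q
  fromℚ-injective {p} {q} eq = trans (back p q) (trans (cong (ℚ._+ q) (Null-const eq)) (ℚₚ.+-identityˡ q))

  point-injective : Injective _≡_ _≈ᴾ_ point
  point-injective (eq , _) = abs-injective (fromℚ-injective eq)

  -- Orienting edges by v < w lists each of them once, as a slope set without repetition requires.
  IsEdge : Fin n × Fin n → Set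
  IsEdge (v , w) = v Fin.< w × Adj G v w

  isEdge? : ∀ e → Dec (IsEdge e)
  isEdge? (v , w) = (v Finₚ.<? w) ×-dec adj? v w

  edges : List (Fin n × Fin n)
  edges = filter isEdge? (cartesianProduct (allFin n) (allFin n))

  edges-unique : Unique edges
  edges-unique = Uniqueₚ.filter⁺ isEdge? (Uniqueₚ.cartesianProduct⁺ (Uniqueₚ.allFin⁺ n) (Uniqueₚ.allFin⁺ n))

  chord : Fin n × Fin n → ℚ
  chord (v , w) = abs v ℚ.+ abs w

  chord-injective : ∀ {v w v′ w′} → v Fin.< w → v′ Fin.< w′ → chord (v , w) ≡ chord (v′ , w′) → v ≡ v′ × w ≡ w′
  chord-injective {v} {w} {v′} {w′} v<w v′<w′ eq =
    let p , q = 2^+2^-injective v<w v′<w′ (node-injective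
          (trans (node-+ (2 ^ toℕ v) (2 ^ toℕ w)) (trans eq (sym (node-+ (2 ^ toℕ v′) (2 ^ toℕ w′))))))
    in Finₚ.toℕ-injective p , Finₚ.toℕ-injective q

  edge-at : ∀ j → IsEdge (List.lookup edges j)
  edge-at j = proj₂ (∈-filter⁻ isEdge? {xs = cartesianProduct (allFin n) (allFin n)} (∈-lookup j))

  slope : Fin (length edges) → Slope
  slope j = just (fromℚ (chord (List.lookup edges j)))

  slope-injective : Injective _≡_ _≈ˢ_ slope
  slope-injective {i} {j} (just eq) = lookup-injective edges-unique
    (let p , q = chord-injective (proj₁ (edge-at i)) (proj₁ (edge-at j)) (fromℚ-injective eq) in cong₂ _,_ p q)

  chord-incidence : ∀ s x x′ → incidence 1ℚ s x (x ℚ.* x) x′ (x′ ℚ.* x′) ≡ (x′ ℚ.- x) ℚ.* ((x ℚ.+ x′) ℚ.- s)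
  chord-incidence = solve 3 (λ s x x′ →
    con 1ℚ :* (x′ :* x′ :- x :* x) :- s :* (x′ :- x) := (x′ :- x) :* ((x :+ x′) :- s)) refl
    where open +-*-Solver

  hasSlope-chord : ∀ {v w s} → v ≢ w → s ≡ chord (v , w) → HasSlope (point v) (point w) (just (fromℚ s))
  hasSlope-chord {v} {w} v≢w refl = null⇒hasSlope (point v) (point w) _ (v≢w ∘ point-injective)
    (Null-resp (λ _ → trans (chord-incidence (chord (v , w)) (abs v) (abs w))
      (trans (cong ((abs w ℚ.- abs v) ℚ.*_) (ℚₚ.+-inverseʳ (chord (v , w)))) (ℚₚ.*-zeroʳ (abs w ℚ.- abs v)))) Null-0)

  chord-hasSlope : ∀ {v w s} → v ≢ w → HasSlope (point v) (point w) (just (fromℚ s)) → chord (v , w) ≡ s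
  chord-hasSlope {v} {w} {s} v≢w h = difference-zero _ _ (*-zero-product (abs w ℚ.- abs v) _
    (λ eq → v≢w (abs-injective (sym (difference-zero _ _ eq))))
    (trans (sym (chord-incidence s (abs v) (abs w))) (Null-const (hasSlope⇒null h))))
    where
    difference-zero : ∀ p q → p ℚ.- q ≡ 0ℚ → p ≡ q
    difference-zero p q eq = trans (back p q) (trans (cong (ℚ._+ q) eq) (ℚₚ.+-identityˡ q))

  edge-slope : ∀ {v w} → IsEdge (v , w) → ∃[ j ] List.lookup edges j ≡ (v , w)
  edge-slope {v} {w} e = index e∈ , sym (lookup-index e∈)
    where
    e∈ : (v , w) ∈ edges
    e∈ = ∈-filter⁺ isEdge? (∈-cartesianProduct⁺ (∈-allFin v) (∈-allFin w)) e

  chord-swap : ∀ v w → chord (v , w) ≡ chord (w , v)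
  chord-swap v w = ℚₚ.+-comm (abs v) (abs w)

  adjacent⇒ : ∀ {v w} → Adj G v w → v ≢ w × ∃[ j ] HasSlope (point v) (point w) (slope j)
  adjacent⇒ {v} {w} adj with Finₚ.<-cmp v w
  ... | tri≈ _ refl _ = contradiction adj (irrefl G v)
  ... | tri< v<w v≢w _ = let j , eq = edge-slope (v<w , adj) in
        v≢w , j , hasSlope-chord v≢w (cong chord eq)
  ... | tri> _ v≢w w<v = let j , eq = edge-slope (w<v , symm G adj) in
        v≢w , j , hasSlope-chord v≢w (trans (cong chord eq) (chord-swap w v))

  -- Distinct pairs have distinct chord slopes, so no non-edge acquires the slope of an edge by
  -- accident.
  chord-edge : ∀ {v w} → v Fin.< w → ∀ j → chord (v , w) ≡ chord (List.lookup edges j) → Adj G v w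
  chord-edge {v} {w} v<w j eq =
    let p , q = chord-injective {v} {w} {proj₁ e} {proj₂ e} v<w (proj₁ (edge-at j)) eq
    in subst₂ (Adj G) (sym p) (sym q) (proj₂ (edge-at j))
    where
    e : Fin n × Fin n
    e = List.lookup edges j

  adjacent⇐ : ∀ {v w} → v ≢ w → ∀ j → HasSlope (point v) (point w) (slope j) → Adj G v w
  adjacent⇐ {v} {w} v≢w j h = case Finₚ.<-cmp v w of λ
    { (tri≈ _ v≡w _) → contradiction v≡w v≢w
    ; (tri< v<w _ _) → chord-edge v<w j (chord-hasSlope v≢w h)
    ; (tri> _ _ w<v) → symm G (chord-edge w<v j (trans (chord-swap w v) (chord-hasSlope v≢w h)))
    }

  realisable : RealisableWith G (length edges)
  realisable = n , (point , point-injective) , (slope , slope-injective) , ↔-id (Fin n)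
    , λ v w → mk⇔ adjacent⇒ λ (v≢w , j , h) → adjacent⇐ v≢w j h

sl-defined : ∀ {n} (G : Graph n) → Decidable (Adj G) → ¬ ¬ (∃[ k ] IsSl G k)
sl-defined G adj? = ¬¬least (RealisableWith G) _ (Parabola.realisable G adj?)

-- Counting

^-distribʳ-* : ∀ a b k → (a * b) ^ k ≡ a ^ k * b ^ k
^-distribʳ-* a b zero    = refl
^-distribʳ-* a b (suc k) = trans (cong (a * b *_) (^-distribʳ-* a b k))
  (interchange a b (a ^ k) (b ^ k))
  where
  interchange : ∀ a b c d → a * b * (c * d) ≡ a * c * (b * d)
  interchange = solve-∀

^-cancelˡ-< : ∀ k {a b} → a ^ k < b ^ k → a < b
^-cancelˡ-< k a^k<b^k = ℕₚ.≰⇒> λ b≤a → ℕₚ.<⇒≱ a^k<b^k (ℕₚ.^-monoˡ-≤ k b≤a)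

!-pos : ∀ t → 0 < t !
!-pos zero    = s≤s z≤n
!-pos (suc t) = ℕₚ.*-mono-≤ {1} {suc t} {1} {t !} (s≤s z≤n) (!-pos t)

-- The quotient (2t)! / t!² is the central binomial coefficient, which grows by a factor of at most
-- 4 when t grows by one.
[2t]!≤4^t*t!² : ∀ t → (t + t) ! ≤ 4 ^ t * (t ! * t !)
[2t]!≤4^t*t!² zero    = ℕₚ.≤-refl
[2t]!≤4^t*t!² (suc t) = begin
  (suc t + suc t) !                                        ≡⟨ cong _! (cong suc (ℕₚ.+-suc t t)) ⟩
  suc (suc (t + t)) * (suc (t + t) * (t + t) !)            ≤⟨ ℕₚ.*-monoʳ-≤ (suc (suc (t + t)))
                                                                (ℕₚ.*-mono-≤ (ℕₚ.n≤1+n (suc (t + t))) ([2t]!≤4^t*t!² t)) ⟩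
  suc (suc (t + t)) * (suc (suc (t + t)) * (4 ^ t * (t ! * t !)))
                                                           ≡⟨ rearrange t (4 ^ t) (t !) ⟩
  4 ^ suc t * (suc t ! * suc t !)                          ∎
  where
  open ℕₚ.≤-Reasoning
  rearrange : ∀ t a f → suc (suc (t + t)) * (suc (suc (t + t)) * (a * (f * f))) ≡
                        4 * a * ((suc t * f) * (suc t * f))
  rearrange = solve-∀

t^k*t!≤[k+t]! : ∀ t k → t ^ k * t ! ≤ (k + t) !
t^k*t!≤[k+t]! t zero    = ℕₚ.≤-reflexive (ℕₚ.+-identityʳ (t !))
t^k*t!≤[k+t]! t (suc k) = begin
  t * t ^ k * t !          ≡⟨ ℕₚ.*-assoc t (t ^ k) (t !) ⟩
  t * (t ^ k * t !)
    ≤⟨ ℕₚ.*-mono-≤ (ℕₚ.≤-trans (ℕₚ.m≤n+m t k) (ℕₚ.n≤1+n (k + t))) (t^k*t!≤[k+t]! t k) ⟩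
  suc (k + t) * (k + t) !  ∎
  where open ℕₚ.≤-Reasoning

-- Both sides times t! compare with (2t)!. This stands in for Stirling's formula; the factor 4^t is
-- absorbed by `H`.
t^t≤4^t*t! : ∀ t → t ^ t ≤ 4 ^ t * t !
t^t≤4^t*t! t = ℕₚ.*-cancelʳ-≤ (t ^ t) (4 ^ t * t !) (t !) {{ℕ.>-nonZero (!-pos t)}} (begin
  t ^ t * t !             ≤⟨ t^k*t!≤[k+t]! t t ⟩
  (t + t) !               ≤⟨ [2t]!≤4^t*t!² t ⟩
  4 ^ t * (t ! * t !)     ≡⟨ ℕₚ.*-assoc (4 ^ t) (t !) (t !) ⟨
  4 ^ t * t ! * t !       ∎)
  where open ℕₚ.≤-Reasoning

module Growth (d L : ℕ) where

  -- H collects the factors exponential in n of the final estimate; (48L)^(4L) yields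
  -- 48LK ≤ n, L * 6912 bounds the power of n lost to the cliques (4 · LΔ · c(Δ + 1)
  -- with Δ ≤ 8 and c ≤ 24), and 648 yields n ≤ 24t.
  Δ H threshold : ℕ
  Δ = 4 + d
  H = 3 ^ (4 * L) * 96 ^ (L * Δ)
  threshold = H * H + ((48 * L) ^ (4 * L) + (L * 6912 + 648))

  648≤ : ∀ {n} → threshold < n → 648 ≤ n
  648≤ n> = ℕₚ.≤-trans (ℕₚ.m≤n+m 648 (L * 6912)) (ℕₚ.≤-trans (ℕₚ.m≤n+m (L * 6912 + 648) ((48 * L) ^ (4 * L)))
    (ℕₚ.≤-trans (ℕₚ.m≤n+m ((48 * L) ^ (4 * L) + (L * 6912 + 648)) (H * H)) (ℕₚ.<⇒≤ n>)))

  -- As p = dL - 1, `K-bound` says K ≤ n^((d - 1/L)/4); fixed powers such as 4L and 2L keep all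
  -- estimates free of roots.
  module Bounds {n t c K p} (d≤4 : d ≤ 4) (n≡ : n ≡ Δ * t + (Δ * t + c * suc Δ)) (c≤24 : c ≤ 24)
           (1≤K : 1 ≤ K) (K-bound : K ^ (4 * L) ≤ n ^ p) (p≡ : suc p ≡ d * L)
           (n> : threshold < n) where
    open ℕₚ.≤-Reasoning

    instance
      n-nonZero : NonZero n
      n-nonZero = ℕ.>-nonZero (ℕₚ.≤-<-trans z≤n n>)

    Δ≤8 : Δ ≤ 8
    Δ≤8 = ℕₚ.+-monoʳ-≤ 4 d≤4

    H²<n : H * H < n
    H²<n = ℕₚ.≤-<-trans (ℕₚ.m≤m+n (H * H) _) n>

    root<n : (48 * L) ^ (4 * L) < n
    root<n = ℕₚ.≤-<-trans (ℕₚ.≤-trans (ℕₚ.m≤m+n ((48 * L) ^ (4 * L)) _) (ℕₚ.m≤n+m _ (H * H))) n>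

    linear<n : L * 6912 + 648 < n
    linear<n = ℕₚ.≤-<-trans (ℕₚ.≤-trans (ℕₚ.m≤n+m (L * 6912 + 648) ((48 * L) ^ (4 * L))) (ℕₚ.m≤n+m _ (H * H))) n>

    remainder : ℕ
    remainder = L * Δ * (c * suc Δ)

    remainder-small : 4 * remainder ≤ n
    remainder-small = begin
      4 * (L * Δ * (c * suc Δ))
        ≤⟨ ℕₚ.*-monoʳ-≤ 4 (ℕₚ.*-mono-≤ (ℕₚ.*-monoʳ-≤ L Δ≤8) (ℕₚ.*-mono-≤ c≤24 (s≤s Δ≤8))) ⟩
      4 * (L * 8 * (24 * 9))       ≡⟨ rearrange L ⟩
      L * 6912                     ≤⟨ ℕₚ.m≤m+n (L * 6912) 648 ⟩
      L * 6912 + 648               ≤⟨ ℕₚ.<⇒≤ linear<n ⟩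
      n                            ∎
      where
      rearrange : ∀ L → 4 * (L * 8 * (24 * 9)) ≡ L * 6912
      rearrange = solve-∀

    -- The essential use of Δ ≤ 8: as p + 1 = dL ≤ 4L, n < 48LK would give n^(p+1) ≤ (48L)^(4L) n^p,
    -- against the threshold.
    K-small : 48 * L * K ≤ n
    K-small = ℕₚ.≮⇒≥ λ n<48LK → ℕₚ.<⇒≱ root<n (ℕₚ.*-cancelʳ-≤ n ((48 * L) ^ (4 * L)) (n ^ p) {{ℕₚ.m^n≢0 n p}} (begin
      n ^ suc p
        ≤⟨ ℕₚ.^-monoʳ-≤ n (ℕₚ.≤-trans (ℕₚ.≤-reflexive p≡) (ℕₚ.*-monoˡ-≤ L d≤4)) ⟩
      n ^ (4 * L)                            ≤⟨ ℕₚ.^-monoˡ-≤ (4 * L) (ℕₚ.<⇒≤ n<48LK) ⟩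
      (48 * L * K) ^ (4 * L)                 ≡⟨ ^-distribʳ-* (48 * L) K (4 * L) ⟩
      (48 * L) ^ (4 * L) * K ^ (4 * L)       ≤⟨ ℕₚ.*-monoʳ-≤ ((48 * L) ^ (4 * L)) K-bound ⟩
      (48 * L) ^ (4 * L) * n ^ p             ∎))

    -- From n ≤ 16t + 216 and 216 ≤ n/3, multiplied by 3 to stay in ℕ; 216 = 24 · 9 bounds the
    -- vertices in cliques.
    n≤24t : n ≤ 24 * t
    n≤24t = ℕₚ.*-cancelˡ-≤ 2 (ℕₚ.+-cancelʳ-≤ n (2 * n) (2 * (24 * t)) (begin
      2 * n + n                                  ≡⟨ triple n ⟩
      3 * n                                      ≡⟨ cong (3 *_) n≡ ⟩
      3 * (Δ * t + (Δ * t + c * suc Δ))          ≤⟨ ℕₚ.*-monoʳ-≤ 3 (ℕₚ.+-mono-≤ (ℕₚ.*-monoˡ-≤ t Δ≤8)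
                                                      (ℕₚ.+-mono-≤ (ℕₚ.*-monoˡ-≤ t Δ≤8) (ℕₚ.*-mono-≤ c≤24 (s≤s Δ≤8)))) ⟩
      3 * (8 * t + (8 * t + 24 * 9))             ≡⟨ expand t ⟩
      2 * (24 * t) + 648
        ≤⟨ ℕₚ.+-monoʳ-≤ (2 * (24 * t)) (ℕₚ.≤-trans (ℕₚ.m≤n+m 648 (L * 6912)) (ℕₚ.<⇒≤ linear<n)) ⟩
      2 * (24 * t) + n                           ∎))
      where
      triple : ∀ n → 2 * n + n ≡ 3 * n
      triple = solve-∀
      expand : ∀ t → 3 * (8 * t + (8 * t + 24 * 9)) ≡ 2 * (24 * t) + 648
      expand = solve-∀

    -- m and s count the nodes per point and per slope variable, R is the square root of the grid
    -- size, X the size of the family, and e the power of n lost to cliques and slope variables.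
    m s R X e : ℕ
    m = suc (K * (n + n))
    s = suc (n * n)
    R = m ^ n * s ^ K
    X = ((t !) ^ Δ) ^ Δ
    e = remainder + 12 * L * K

    e-small : 2 * e ≤ n
    e-small = ℕₚ.*-cancelˡ-≤ 2 (begin
      2 * (2 * e)                          ≡⟨ expand remainder L K ⟩
      4 * remainder + 48 * L * K           ≤⟨ ℕₚ.+-mono-≤ remainder-small K-small ⟩
      n + n                                ≡⟨ cong (λ z → n + z) (ℕₚ.+-identityʳ n) ⟨
      2 * n                                ∎)
      where
      expand : ∀ r L K → 2 * (2 * (r + 12 * L * K)) ≡ 4 * r + 48 * L * K
      expand = solve-∀

    1≤n : 1 ≤ n
    1≤n = ℕ.>-nonZero⁻¹ n

    -- The exponents add up exactly: 4L from n, p from K and 1 from the extra factor n make 4L + dL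
    -- = LΔ.
    m-bound : m ^ (4 * L) * n ≤ 3 ^ (4 * L) * n ^ (L * Δ)
    m-bound = begin
      m ^ (4 * L) * n
        ≤⟨ ℕₚ.*-monoˡ-≤ n (ℕₚ.^-monoˡ-≤ (4 * L) m≤3nK) ⟩
      (3 * (n * K)) ^ (4 * L) * n
        ≡⟨ cong (_* n) (trans (^-distribʳ-* 3 (n * K) (4 * L))
             (cong (3 ^ (4 * L) *_) (^-distribʳ-* n K (4 * L)))) ⟩
      3 ^ (4 * L) * (n ^ (4 * L) * K ^ (4 * L)) * n
        ≤⟨ ℕₚ.*-monoˡ-≤ n (ℕₚ.*-monoʳ-≤ (3 ^ (4 * L)) (ℕₚ.*-monoʳ-≤ (n ^ (4 * L)) K-bound)) ⟩
      3 ^ (4 * L) * (n ^ (4 * L) * n ^ p) * n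
        ≡⟨ rearrange (3 ^ (4 * L)) (n ^ (4 * L)) (n ^ p) n ⟩
      3 ^ (4 * L) * (n ^ (4 * L) * n ^ suc p)
        ≡⟨ cong (3 ^ (4 * L) *_) (ℕₚ.^-distribˡ-+-* n (4 * L) (suc p)) ⟨
      3 ^ (4 * L) * n ^ (4 * L + suc p)
        ≡⟨ cong (λ k → 3 ^ (4 * L) * n ^ k) (trans (cong (λ z → 4 * L + z) p≡) (exponent d L)) ⟩
      3 ^ (4 * L) * n ^ (L * Δ)                              ∎
      where
      rearrange : ∀ a b c n → a * (b * c) * n ≡ a * (b * (n * c))
      rearrange = solve-∀
      exponent : ∀ d L → 4 * L + d * L ≡ L * (4 + d)
      exponent = solve-∀
      m≤3nK : m ≤ 3 * (n * K)
      m≤3nK = begin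
        1 + K * (n + n)            ≤⟨ ℕₚ.+-monoˡ-≤ (K * (n + n)) (ℕₚ.*-mono-≤ 1≤n 1≤K) ⟩
        n * K + K * (n + n)        ≡⟨ sum n K ⟩
        3 * (n * K)                ∎
        where
        sum : ∀ n K → n * K + K * (n + n) ≡ 3 * (n * K)
        sum = solve-∀

    s-bound : (s ^ K) ^ (4 * L) ≤ n ^ (12 * L * K)
    s-bound = begin
      (s ^ K) ^ (4 * L)          ≤⟨ ℕₚ.^-monoˡ-≤ (4 * L) (ℕₚ.^-monoˡ-≤ K s≤n³) ⟩
      ((n ^ 3) ^ K) ^ (4 * L)
        ≡⟨ trans (cong (_^ (4 * L)) (ℕₚ.^-*-assoc n 3 K)) (ℕₚ.^-*-assoc n (3 * K) (4 * L)) ⟩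
      n ^ (3 * K * (4 * L))      ≡⟨ cong (n ^_) (exponent K L) ⟩
      n ^ (12 * L * K)           ∎
      where
      exponent : ∀ K L → 3 * K * (4 * L) ≡ 12 * L * K
      exponent = solve-∀
      2≤n : 2 ≤ n
      2≤n = ℕₚ.≤-trans (ℕₚ.m≤n+m 2 (L * 6912 + 646)) (ℕₚ.≤-trans (ℕₚ.≤-reflexive (ℕₚ.+-assoc (L * 6912) 646 2)) (ℕₚ.<⇒≤ linear<n))
      s≤n³ : s ≤ n ^ 3
      s≤n³ = begin
        1 + n * n                ≤⟨ ℕₚ.+-monoˡ-≤ (n * n) (ℕₚ.*-mono-≤ 1≤n 1≤n) ⟩
        n * n + n * n            ≡⟨ double n ⟩
        2 * (n * n)              ≤⟨ ℕₚ.*-monoˡ-≤ (n * n) 2≤n ⟩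
        n * (n * n)              ≡⟨ cong (λ k → n * (n * k)) (ℕₚ.*-identityʳ n) ⟨
        n ^ 3                    ∎
        where
        double : ∀ n → n * n + n * n ≡ 2 * (n * n)
        double = solve-∀

    n^t-bound : n ^ t ≤ 96 ^ t * t !
    n^t-bound = begin
      n ^ t                      ≤⟨ ℕₚ.^-monoˡ-≤ t n≤24t ⟩
      (24 * t) ^ t               ≡⟨ ^-distribʳ-* 24 t t ⟩
      24 ^ t * t ^ t             ≤⟨ ℕₚ.*-monoʳ-≤ (24 ^ t) (t^t≤4^t*t! t) ⟩
      24 ^ t * (4 ^ t * t !)     ≡⟨ ℕₚ.*-assoc (24 ^ t) (4 ^ t) (t !) ⟨
      24 ^ t * 4 ^ t * t !       ≡⟨ cong (_* t !) (^-distribʳ-* 24 4 t) ⟨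
      96 ^ t * t !               ∎

    -- Since LΔn = 2LΔ²t + `remainder`, the power 2LΔ² of `n^t-bound` produces the 2L-th power of X
    -- = t!^(Δ²).
    main-bound : n ^ (L * Δ * n) ≤ 96 ^ (L * Δ * n) * X ^ (2 * L) * n ^ remainder
    main-bound = begin
      n ^ (L * Δ * n)
        ≡⟨ cong (n ^_) (trans (cong (L * Δ *_) n≡) (exponent L Δ t (c * suc Δ))) ⟩
      n ^ (t * (Δ * Δ * (2 * L)) + remainder)
        ≡⟨ ℕₚ.^-distribˡ-+-* n (t * (Δ * Δ * (2 * L))) remainder ⟩
      n ^ (t * (Δ * Δ * (2 * L))) * n ^ remainder
        ≡⟨ cong (_* n ^ remainder) (ℕₚ.^-*-assoc n t (Δ * Δ * (2 * L))) ⟨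
      (n ^ t) ^ (Δ * Δ * (2 * L)) * n ^ remainder
        ≤⟨ ℕₚ.*-monoˡ-≤ (n ^ remainder) (ℕₚ.^-monoˡ-≤ (Δ * Δ * (2 * L)) n^t-bound) ⟩
      (96 ^ t * t !) ^ (Δ * Δ * (2 * L)) * n ^ remainder
        ≡⟨ cong (_* n ^ remainder) (^-distribʳ-* (96 ^ t) (t !) (Δ * Δ * (2 * L))) ⟩
      (96 ^ t) ^ (Δ * Δ * (2 * L)) * (t !) ^ (Δ * Δ * (2 * L)) * n ^ remainder
        ≡⟨ cong₂ (λ a b → a * b * n ^ remainder) (ℕₚ.^-*-assoc 96 t (Δ * Δ * (2 * L)))
             (trans (sym (ℕₚ.^-*-assoc (t !) (Δ * Δ) (2 * L))) (cong (_^ (2 * L)) (sym (ℕₚ.^-*-assoc (t !) Δ Δ)))) ⟩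
      96 ^ (t * (Δ * Δ * (2 * L))) * X ^ (2 * L) * n ^ remainder
        ≤⟨ ℕₚ.*-monoˡ-≤ (n ^ remainder) (ℕₚ.*-monoˡ-≤ (X ^ (2 * L)) (ℕₚ.^-monoʳ-≤ 96 exponent≤)) ⟩
      96 ^ (L * Δ * n) * X ^ (2 * L) * n ^ remainder ∎
      where
      exponent : ∀ L Δ t r → L * Δ * (Δ * t + (Δ * t + r)) ≡ t * (Δ * Δ * (2 * L)) + L * Δ * r
      exponent = solve-∀
      exponent≤ : t * (Δ * Δ * (2 * L)) ≤ L * Δ * n
      exponent≤ = begin
        t * (Δ * Δ * (2 * L))                        ≤⟨ ℕₚ.m≤m+n _ remainder ⟩
        t * (Δ * Δ * (2 * L)) + remainder            ≡⟨ exponent L Δ t (c * suc Δ) ⟨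
        L * Δ * (Δ * t + (Δ * t + c * suc Δ))        ≡⟨ cong (L * Δ *_) n≡ ⟨
        L * Δ * n                                    ∎

    -- The factor n ^ n makes up for the -1 in p = dL - 1; it is what absorbs the error H ^ n * n ^ e.
    R-bound : R ^ (4 * L) * n ^ n ≤ H ^ n * n ^ e * X ^ (2 * L)
    R-bound = begin
      R ^ (4 * L) * n ^ n
        ≡⟨ cong (_* n ^ n) (^-distribʳ-* (m ^ n) (s ^ K) (4 * L)) ⟩
      (m ^ n) ^ (4 * L) * (s ^ K) ^ (4 * L) * n ^ n
        ≡⟨ cong (λ a → a * (s ^ K) ^ (4 * L) * n ^ n) (^-comm m n (4 * L)) ⟩
      (m ^ (4 * L)) ^ n * (s ^ K) ^ (4 * L) * n ^ n
        ≡⟨ swap ((m ^ (4 * L)) ^ n) ((s ^ K) ^ (4 * L)) (n ^ n) ⟩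
      (m ^ (4 * L)) ^ n * n ^ n * (s ^ K) ^ (4 * L)
        ≡⟨ cong (_* (s ^ K) ^ (4 * L)) (^-distribʳ-* (m ^ (4 * L)) n n) ⟨
      (m ^ (4 * L) * n) ^ n * (s ^ K) ^ (4 * L)
        ≤⟨ ℕₚ.*-mono-≤ (ℕₚ.^-monoˡ-≤ n m-bound) s-bound ⟩
      (3 ^ (4 * L) * n ^ (L * Δ)) ^ n * n ^ (12 * L * K)
        ≡⟨ cong (_* n ^ (12 * L * K)) (trans (^-distribʳ-* (3 ^ (4 * L)) (n ^ (L * Δ)) n)
             (cong ((3 ^ (4 * L)) ^ n *_) (ℕₚ.^-*-assoc n (L * Δ) n))) ⟩
      (3 ^ (4 * L)) ^ n * n ^ (L * Δ * n) * n ^ (12 * L * K)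
        ≤⟨ ℕₚ.*-monoˡ-≤ (n ^ (12 * L * K)) (ℕₚ.*-monoʳ-≤ ((3 ^ (4 * L)) ^ n) main-bound) ⟩
      (3 ^ (4 * L)) ^ n * (96 ^ (L * Δ * n) * X ^ (2 * L) * n ^ remainder) * n ^ (12 * L * K)
        ≡⟨ rearrange ((3 ^ (4 * L)) ^ n) (96 ^ (L * Δ * n)) (X ^ (2 * L)) (n ^ remainder) (n ^ (12 * L * K)) ⟩
      (3 ^ (4 * L)) ^ n * 96 ^ (L * Δ * n) * (n ^ remainder * n ^ (12 * L * K)) * X ^ (2 * L)
        ≡⟨ cong₂ (λ a b → a * b * X ^ (2 * L))
             (trans (cong ((3 ^ (4 * L)) ^ n *_) (sym (ℕₚ.^-*-assoc 96 (L * Δ) n)))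
                    (sym (^-distribʳ-* (3 ^ (4 * L)) (96 ^ (L * Δ)) n)))
             (sym (ℕₚ.^-distribˡ-+-* n remainder (12 * L * K))) ⟩
      H ^ n * n ^ e * X ^ (2 * L) ∎
      where
      ^-comm : ∀ a j k → (a ^ j) ^ k ≡ (a ^ k) ^ j
      ^-comm a j k = trans (ℕₚ.^-*-assoc a j k) (trans (cong (a ^_) (ℕₚ.*-comm j k)) (sym (ℕₚ.^-*-assoc a k j)))
      swap : ∀ a b c → a * b * c ≡ a * c * b
      swap = solve-∀
      rearrange : ∀ a b x r q → a * (b * x * r) * q ≡ a * b * (r * q) * x
      rearrange = solve-∀

    -- n^e takes at most half of the exponent n, and H < n^(1/2) leaves H^n below the other half;
    -- squaring avoids the halves.
    error-bound : H ^ n * n ^ e < n ^ n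
    error-bound = ^-cancelˡ-< 2 (begin-strict
      (H ^ n * n ^ e) ^ 2                ≡⟨ ^-distribʳ-* (H ^ n) (n ^ e) 2 ⟩
      (H ^ n) ^ 2 * (n ^ e) ^ 2
        ≡⟨ cong₂ _*_ (trans (square (H ^ n)) (sym (^-distribʳ-* H H n)))
             (trans (ℕₚ.^-*-assoc n e 2) (cong (n ^_) (ℕₚ.*-comm e 2))) ⟩
      (H * H) ^ n * n ^ (2 * e)          ≤⟨ ℕₚ.*-monoʳ-≤ ((H * H) ^ n) (ℕₚ.^-monoʳ-≤ n e-small) ⟩
      (H * H) ^ n * n ^ n
        <⟨ ℕₚ.*-monoˡ-< (n ^ n) {{ℕₚ.m^n≢0 n n}} (ℕₚ.^-monoˡ-< n H²<n) ⟩
      n ^ n * n ^ n                      ≡⟨ square (n ^ n) ⟨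
      (n ^ n) ^ 2                        ∎)
      where
      square : ∀ a → a ^ 2 ≡ a * a
      square a = cong (a *_) (ℕₚ.*-identityʳ a)

    R²<X : R * R < X
    R²<X = ^-cancelˡ-< (2 * L) (begin-strict
      (R * R) ^ (2 * L)
        ≡⟨ trans (^-distribʳ-* R R (2 * L)) (sym (ℕₚ.^-distribˡ-+-* R (2 * L) (2 * L))) ⟩
      R ^ (2 * L + 2 * L)    ≡⟨ cong (R ^_) (exponent L) ⟩
      R ^ (4 * L)            <⟨ ℕₚ.*-cancelʳ-< (n ^ n) (R ^ (4 * L)) (X ^ (2 * L)) (begin-strict
          R ^ (4 * L) * n ^ n             ≤⟨ R-bound ⟩
          H ^ n * n ^ e * X ^ (2 * L)     <⟨ ℕₚ.*-monoˡ-< (X ^ (2 * L)) {{X-nonZero}} error-bound ⟩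
          n ^ n * X ^ (2 * L)             ≡⟨ ℕₚ.*-comm (n ^ n) (X ^ (2 * L)) ⟩
          X ^ (2 * L) * n ^ n             ∎) ⟩
      X ^ (2 * L)            ∎)
      where
      exponent : ∀ L → 2 * L + 2 * L ≡ 4 * L
      exponent = solve-∀
      X-nonZero : NonZero (X ^ (2 * L))
      X-nonZero = ℕₚ.m^n≢0 X (2 * L) {{ℕₚ.m^n≢0 ((t !) ^ Δ) Δ {{ℕₚ.m^n≢0 (t !) Δ {{ℕ.>-nonZero (!-pos t)}}}}}}

    gridSize<X : gridSize n K < X
    gridSize<X = subst (_< X) (interchange (m ^ n) (s ^ K)) R²<X
      where
      interchange : ∀ a b → a * b * (a * b) ≡ a * a * (b * b)
      interchange = solve-∀

-- Block length and number of cliques for a given order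

2∣r⊎2∣1+r : ∀ r → 2 ∣ r ⊎ 2 ∣ suc r
2∣r⊎2∣1+r zero    = inj₁ (2 ∣0)
2∣r⊎2∣1+r (suc r) with 2∣r⊎2∣1+r r
... | inj₁ 2∣r   = inj₂ (∣m∣n⇒∣m+n {n = r} ∣-refl 2∣r)
... | inj₂ 2∣1+r = inj₁ 2∣1+r

-- For even r, r cliques have r(Δ + 1) = r + 2Δ · (r/2) vertices.
clique-count-even : ∀ Δ r → 2 ∣ r → ∃[ c ] ∃[ e ] (c * suc Δ ≡ r + (Δ + Δ) * e × c ≤ r + Δ × e ≤ suc (r + Δ))
clique-count-even Δ r (divides e refl) = e * 2 , e , expand e Δ
  , ℕₚ.m≤m+n (e * 2) Δ , ℕₚ.≤-trans (ℕₚ.m≤m*n e 2) (ℕₚ.≤-trans (ℕₚ.m≤m+n (e * 2) Δ) (ℕₚ.n≤1+n _))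
  where
  expand : ∀ e Δ → e * 2 * suc Δ ≡ e * 2 + (Δ + Δ) * e
  expand = solve-∀

-- The bipartite part has a multiple of 2Δ vertices, so c cliques on Δ + 1 vertices
-- have to account for the residue r of n modulo 2Δ.
clique-count : ∀ Δ r → 2 ∣ r ⊎ 2 ∣ Δ →
  ∃[ c ] ∃[ e ] (c * suc Δ ≡ r + (Δ + Δ) * e × c ≤ r + Δ × e ≤ suc (r + Δ))
clique-count Δ r parity with 2∣r⊎2∣1+r r | parity
... | inj₁ 2∣r   | _        = clique-count-even Δ r 2∣r
... | inj₂ 2∣1+r | inj₁ 2∣r = clique-count-even Δ r 2∣r
... | inj₂ 2∣1+r | inj₂ 2∣Δ with ∣m∣n⇒∣m+n 2∣1+r 2∣Δ
-- Here r + Δ + 1 = 2e, and r + Δ cliques have r + Δ(r + Δ + 1) = r + 2Δe vertices.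
...   | divides e eq = r + Δ , e , odd
  , ℕₚ.≤-refl , ℕₚ.≤-trans (ℕₚ.m≤m*n e 2) (ℕₚ.≤-reflexive (sym eq))
  where
  open ≡-Reasoning
  odd : (r + Δ) * suc Δ ≡ r + (Δ + Δ) * e
  odd = begin
    (r + Δ) * suc Δ              ≡⟨ expand r Δ ⟩
    r + Δ * suc (r + Δ)          ≡⟨ cong (λ k → r + Δ * k) eq ⟩
    r + Δ * (e * 2)              ≡⟨ cong (λ z → r + z) (double Δ e) ⟩
    r + (Δ + Δ) * e              ∎
    where
    expand : ∀ r Δ → (r + Δ) * suc Δ ≡ r + Δ * suc (r + Δ)
    expand = solve-∀
    double : ∀ Δ e → Δ * (e * 2) ≡ (Δ + Δ) * e
    double = solve-∀

-- Write n = r + 2Δq. The cliques take r + 2Δe vertices and leave 2Δ(q - e) for the blocks; e ≤ 25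
-- and n > 416 = 16 + 25 · 16 force e ≤ q. If n is even, so is r, the modulus 2Δ being even.
decompose : ∀ d n → d ≤ 4 → 648 ≤ n → 2 ∣ (4 + d) * n →
  let Δ = 4 + d in ∃[ t ] ∃[ c ] (n ≡ Δ * t + (Δ * t + c * suc Δ) × c ≤ 24)
decompose d n d≤4 648≤n 2∣Δn with clique-count (4 + d) (n % (4 + d + (4 + d))) even
  where
  even : 2 ∣ n % (4 + d + (4 + d)) ⊎ 2 ∣ 4 + d
  even with euclidsLemma (4 + d) n prime[2] 2∣Δn
  ... | inj₁ 2∣Δ = inj₂ 2∣Δ
  ... | inj₂ 2∣n = inj₁ (%-presˡ-∣ 2∣n (divides (4 + d) (double d)))
    where
    double : ∀ d → 4 + d + (4 + d) ≡ (4 + d) * 2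
    double = solve-∀
... | c , e , c-eq , c≤ , e≤ = q ℕ.∸ e , c , n≡ , ℕₚ.≤-trans c≤ r+Δ≤24
  where
  open ℕₚ.≤-Reasoning
  Δ r q t : ℕ
  Δ = 4 + d
  r = n % (Δ + Δ)
  q = n ℕ./ (Δ + Δ)
  t = q ℕ.∸ e
  Δ≤8 : Δ ≤ 8
  Δ≤8 = ℕₚ.+-monoʳ-≤ 4 d≤4
  r≤16 : r ≤ 16
  r≤16 = ℕₚ.≤-trans (ℕₚ.<⇒≤ (DivMod.m%n<n n (Δ + Δ))) (ℕₚ.+-mono-≤ Δ≤8 Δ≤8)
  r+Δ≤24 : r + Δ ≤ 24
  r+Δ≤24 = ℕₚ.+-mono-≤ r≤16 Δ≤8
  n≡r+q : n ≡ r + q * (Δ + Δ)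
  n≡r+q = DivMod.m≡m%n+[m/n]*n n (Δ + Δ)
  e≤q : e ≤ q
  e≤q = ℕₚ.≮⇒≥ λ q<e → ℕₚ.<⇒≱ (ℕₚ.<-≤-trans (ℕₚ.m≤m+n 417 231) 648≤n) (begin
    n                        ≡⟨ n≡r+q ⟩
    r + q * (Δ + Δ)
      ≤⟨ ℕₚ.+-mono-≤ r≤16 (ℕₚ.*-mono-≤ (ℕₚ.≤-trans (ℕₚ.<⇒≤ q<e) (ℕₚ.≤-trans e≤ (s≤s r+Δ≤24))) (ℕₚ.+-mono-≤ Δ≤8 Δ≤8)) ⟩
    16 + 25 * (8 + 8)        ≡⟨⟩
    416                      ∎)
  n≡ : n ≡ Δ * t + (Δ * t + c * suc Δ)
  n≡ = begin-equality
    n                                    ≡⟨ n≡r+q ⟩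
    r + q * (Δ + Δ)                      ≡⟨ cong (λ k → r + k * (Δ + Δ)) (ℕₚ.m+[n∸m]≡n e≤q) ⟨
    r + (e + t) * (Δ + Δ)                ≡⟨ rearrange r e t Δ ⟩
    Δ * t + (Δ * t + (r + (Δ + Δ) * e))  ≡⟨ cong (λ k → Δ * t + (Δ * t + k)) c-eq ⟨
    Δ * t + (Δ * t + c * suc Δ)          ∎
    where
    rearrange : ∀ r e t Δ → r + (e + t) * (Δ + Δ) ≡ Δ * t + (Δ * t + (r + (Δ + Δ) * e))
    rearrange = solve-∀

-- Rational exponents

integer-root : ∀ Q .{{_ : NonZero Q}} N → ∃[ K ] (K ^ Q ≤ N × N < suc K ^ Q)
integer-root Q@(suc _) zero = 0 , z≤n , ℕₚ.m^n>0 1 Q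
integer-root Q (suc N) with integer-root Q N
... | K , K^Q≤N , N< with suc K ^ Q ℕₚ.≤? suc N
...   | no  ≰ = K , ℕₚ.m≤n⇒m≤1+n K^Q≤N , ℕₚ.≰⇒> ≰
...   | yes ≤ = suc K , ≤ , ℕₚ.≤-<-trans N< (ℕₚ.^-monoˡ-< Q (ℕₚ.n<1+n (suc K)))

unit-fraction-below : ∀ {η} → 0ℚ ℚ.< η → ∃[ l ] (+ 1 / suc l) ℚ.< η
unit-fraction-below {mkℚ (+ 0) d _} (ℚ.*<* (+<+ ()))
-- (k + 1)/(d + 1) ≥ 1/(d + 1) > 1/(d + 2).
unit-fraction-below {mkℚ +[1+ k ] d _} _ = suc d , ℚₚ.toℚᵘ-cancel-<
  (ℚᵘₚ.<-respˡ-≃ (ℚᵘₚ.≃-sym (ℚₚ.toℚᵘ-fromℚᵘ (mkℚᵘ (+ 1) (suc d))))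
    (*<* (+<+ (ℕₚ.<-≤-trans (subst (_< suc (suc d)) (sym (ℕₚ.*-identityˡ (suc d))) (ℕₚ.n<1+n (suc d)))
                            (ℕₚ.m≤m+n (suc (suc d)) (k * suc (suc d)))))))
unit-fraction-below {mkℚ -[1+ k ] d _} (ℚ.*<* ())

exponent-numerators : ∀ d l →
  ((+ suc d ℤ.* + suc l ℤ.+ ℤ.- (+ 1) ℤ.* + 1) ℤ.* + 1) ℤ.* + (4 * suc l) ≡
  + (l + d * suc l) ℤ.* + (suc (l + 0) * 4)
exponent-numerators d l = begin
  ((+ suc d ℤ.* + suc l ℤ.+ ℤ.- (+ 1) ℤ.* + 1) ℤ.* + 1) ℤ.* + (4 * suc l)
    ≡⟨ cong (((+ suc d ℤ.* + suc l ℤ.+ ℤ.- (+ 1) ℤ.* + 1) ℤ.* + 1) ℤ.*_) (ℤₚ.pos-* 4 (suc l)) ⟩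
  ((+ suc d ℤ.* + suc l ℤ.+ ℤ.- (+ 1) ℤ.* + 1) ℤ.* + 1) ℤ.* (+ 4 ℤ.* + suc l)
    ≡⟨ identity (+ d) (+ l) ⟩
  (+ l ℤ.+ + d ℤ.* + suc l) ℤ.* (+ suc l ℤ.* + 4)
    ≡⟨ cong₂ ℤ._*_ (cong (λ z → + l ℤ.+ z) (sym (ℤₚ.pos-* d (suc l))))
         (trans (sym (ℤₚ.pos-* (suc l) 4)) (cong (λ k → + (suc k * 4)) (sym (ℕₚ.+-identityʳ l)))) ⟩
  + (l + d * suc l) ℤ.* + (suc (l + 0) * 4) ∎
  where
  open ≡-Reasoning
  identity : ∀ x y →
    (((ℤ.1ℤ ℤ.+ x) ℤ.* (ℤ.1ℤ ℤ.+ y) ℤ.+ ℤ.- ℤ.1ℤ ℤ.* ℤ.1ℤ) ℤ.* ℤ.1ℤ) ℤ.* (+ 4 ℤ.* (ℤ.1ℤ ℤ.+ y)) ≡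
    (y ℤ.+ x ℤ.* (ℤ.1ℤ ℤ.+ y)) ℤ.* ((ℤ.1ℤ ℤ.+ y) ℤ.* + 4)
  identity = ℤSolver.solve-∀

-- With L = suc l, the numerator suc d · L - 1 is written without subtraction. In unnormalised
-- fractions the claim becomes an identity of integers.
exponent-fraction : ∀ d l → ((+ suc d / 1) ℚ.- (+ 1 / suc l)) ℚ.* (+ 1 / 4) ≡ + (l + d * suc l) / (4 * suc l)
exponent-fraction d l = ℚₚ.toℚᵘ-injective (begin
  ℚ.toℚᵘ (((+ suc d / 1) ℚ.- (+ 1 / suc l)) ℚ.* (+ 1 / 4))
    ≈⟨ ℚₚ.toℚᵘ-homo-* ((+ suc d / 1) ℚ.- (+ 1 / suc l)) (+ 1 / 4) ⟩
  ℚ.toℚᵘ ((+ suc d / 1) ℚ.- (+ 1 / suc l)) ℚᵘ.* ℚ.toℚᵘ (+ 1 / 4)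
    ≈⟨ ℚᵘₚ.*-cong {v = ℚ.toℚᵘ (+ 1 / 4)} (ℚᵘₚ.≃-trans (ℚₚ.toℚᵘ-homo-+ (+ suc d / 1) (ℚ.- (+ 1 / suc l)))
         (ℚᵘₚ.+-cong (ℚₚ.toℚᵘ-fromℚᵘ (mkℚᵘ (+ suc d) 0))
           (ℚᵘₚ.≃-trans (ℚₚ.toℚᵘ-homo‿- (+ 1 / suc l)) (ℚᵘₚ.-‿cong (ℚₚ.toℚᵘ-fromℚᵘ (mkℚᵘ (+ 1) l))))))
         ℚᵘₚ.≃-refl ⟩
  (mkℚᵘ (+ suc d) 0 ℚᵘ.+ ℚᵘ.- mkℚᵘ (+ 1) l) ℚᵘ.* mkℚᵘ (+ 1) 3
    ≈⟨ *≡* (exponent-numerators d l) ⟩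
  mkℚᵘ (+ (l + d * suc l)) (l + 3 * suc l)
    ≈⟨ ℚₚ.toℚᵘ-fromℚᵘ (mkℚᵘ (+ (l + d * suc l)) (l + 3 * suc l)) ⟨
  ℚ.toℚᵘ (+ (l + d * suc l) / (4 * suc l)) ∎)
  where open ℚᵘₚ.≃-Reasoning

-- The exponent (Δ - 4 - ε) / 4 is below p/q = (Δ - 4 - 1/L) / 4, where L = suc l.
exponent-below : ∀ Δ d ε → (+ Δ / 1) ℚ.- (+ 4 / 1) ≡ + suc d / 1 → fromℕ 0 <ᴿ ε →
  ∃[ l ] ((fromℕ Δ -ᴿ fromℕ 4 -ᴿ ε) *ᴿ fromℚ (+ 1 / 4) <ᴿ fromℚ (+ (l + d * suc l) / (4 * suc l)))
exponent-below Δ d ε Δ-4≡ (η , 0<η , N , η≤) with unit-fraction-below 0<η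
-- Eventually ε ≥ η, so replacing ε by r < η leaves the slack η - r, divided by 4.
... | l , r<η = l , (η ℚ.- r) ℚ.* ¼ , *-pos 0<η-r (ℚₚ.positive⁻¹ ¼) , N , below
  where
  open ℚₚ.≤-Reasoning
  open +-*-Solver
  r ¼ : ℚ
  r = + 1 / suc l
  ¼ = + 1 / 4
  0<η-r : 0ℚ ℚ.< η ℚ.- r
  0<η-r = subst (ℚ._< η ℚ.- r) (ℚₚ.+-inverseʳ r) (ℚₚ.+-monoˡ-< (ℚ.- r) r<η)
  below : ∀ n → N ≤ n →
    ((+ Δ / 1 ℚ.- + 4 / 1) ℚ.- seq ε n) ℚ.* ¼ ℚ.+ (η ℚ.- r) ℚ.* ¼ ℚ.≤ + (l + d * suc l) / (4 * suc l)
  below n N≤n = begin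
    ((+ Δ / 1 ℚ.- + 4 / 1) ℚ.- seq ε n) ℚ.* ¼ ℚ.+ (η ℚ.- r) ℚ.* ¼
      ≡⟨ cong (λ z → (z ℚ.- seq ε n) ℚ.* ¼ ℚ.+ (η ℚ.- r) ℚ.* ¼) Δ-4≡ ⟩
    (D ℚ.- seq ε n) ℚ.* ¼ ℚ.+ (η ℚ.- r) ℚ.* ¼
      ≡⟨ solve 5 (λ D e η r q → (D :- e) :* q :+ (η :- r) :* q := ((D :- r :- e) :+ η) :* q) refl D (seq ε n) η r ¼ ⟩
    ((D ℚ.- r ℚ.- seq ε n) ℚ.+ η) ℚ.* ¼
      ≤⟨ ℚₚ.*-monoʳ-≤-nonNeg ¼ (ℚₚ.+-monoʳ-≤ (D ℚ.- r ℚ.- seq ε n)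
           (subst (ℚ._≤ seq ε n) (ℚₚ.+-identityˡ η) (η≤ n N≤n))) ⟩
    ((D ℚ.- r ℚ.- seq ε n) ℚ.+ seq ε n) ℚ.* ¼
      ≡⟨ cong (ℚ._* ¼) (sym (back (D ℚ.- r) (seq ε n))) ⟩
    (D ℚ.- r) ℚ.* ¼
      ≡⟨ exponent-fraction d l ⟩
    + (l + d * suc l) / (4 * suc l) ∎
    where
    D : ℚ
    D = + suc d / 1

-- The graph with large slope parameter

edge⇒0<k : ∀ {n} (G : Graph n) {v w} → Adj G v w → ∀ k → RealisableWith G k → 1 ≤ k
edge⇒0<k G adj zero    (_ , _ , _ , _ , iso) = case proj₁ (proj₂ (Equivalence.to (iso _ _) adj)) of λ ()
edge⇒0<k G adj (suc k) _                     = s≤s z≤n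

block-unrealisable : ∀ δ t c K → 0 < Family.order (suc δ) t c →
  gridSize (Family.order (suc δ) t c) K < ((t !) ^ suc δ) ^ suc δ →
  Σ[ G ∈ Graph (Family.order (suc δ) t c) ]
    (Regular (suc δ) G × ¬ ¬ (∃[ k ] IsSl G k) × (∀ k → RealisableWith G k → K < k))
block-unrealisable δ t c K 0<order size< =
  let i₀ , unrealisable = unrealisable-member {K = K} G dec separated size<
      v₀ = fromℕ< 0<order
      neighbour₀ = NeighbourGraph.neighbour vertices (neighbours (π i₀)) v₀ zero
  in G i₀ , NeighbourGraph.regular vertices (neighbours (π i₀)) , sl-defined (G i₀) (dec i₀)
     , λ k realisable → ℕₚ.≰⇒> λ k≤K →
         unrealisable k (edge⇒0<k (G i₀) {v₀} {neighbour₀} (zero , refl) k realisable) k≤K realisable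
  where
  open Family (suc δ) t c
  π : Fin (((t !) ^ suc δ) ^ suc δ) → Fin (suc δ) → Fin (suc δ) → Permutation t t
  π = permutations (suc δ) t
  G : Fin (((t !) ^ suc δ) ^ suc δ) → Graph order
  G i = blockGraph (π i)
  dec : ∀ i → Decidable (Adj (G i))
  dec i = NeighbourGraph.adj? vertices (neighbours (π i))
  separated : ∀ i i′ → i ≢ i′ → ∃[ v ] ∃[ w ] (Adj (G i) v w × ¬ Adj (G i′) v w)
  separated i i′ i≢i′ = let a , b , j , ne = permutations-differ (suc δ) t i i′ i≢i′ in
    blockGraph-separated (π i) (π i′) a b j ne

-- With Δ - 4 written as suc d, the relation suc p ≡ suc d * suc l holds by computation, hence the
-- `refl` passed to `Growth.Bounds`.
regular-unrealisable : ∀ d l n K → suc d ≤ 4 → Growth.threshold (suc d) (suc l) < n →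
  2 ∣ (4 + suc d) * n → 1 ≤ K → K ^ (4 * suc l) ≤ n ^ (l + d * suc l) →
  Σ[ G ∈ Graph n ] (Regular (4 + suc d) G × ¬ ¬ (∃[ k ] IsSl G k) × (∀ k → RealisableWith G k → K < k))
regular-unrealisable d l n K d<4 n> 2∣Δn 1≤K K-bound =
  let t , c , n≡ , c≤24 = decompose (suc d) n d<4 (Growth.648≤ (suc d) (suc l) n>) 2∣Δn
  in subst P (sym n≡) (block-unrealisable (4 + d) t c K (subst (0 <_) n≡ (ℕₚ.≤-<-trans z≤n n>))
       (subst (λ m → gridSize m K < ((t !) ^ (4 + suc d)) ^ (4 + suc d)) n≡
         (Growth.Bounds.gridSize<X (suc d) (suc l) {t = t} {c} {p = l + d * suc l} d<4 n≡ c≤24 1≤K K-bound refl n>)))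
  where
  P : ℕ → Set₁
  P m = Σ[ G ∈ Graph m ]
    (Regular (4 + suc d) G × ¬ ¬ (∃[ k ] IsSl G k) × (∀ k → RealisableWith G k → K < k))

large-slope-parameter : ∀ Δ d → Δ ≡ 4 + suc d → suc d ≤ 4 → (+ Δ / 1) ℚ.- (+ 4 / 1) ≡ + suc d / 1 →
  ∀ ε → fromℕ 0 <ᴿ ε →
  ∃[ n₀ ] (∀ n → n > n₀ → 2 ∣ Δ * n →
    ∃[ G ] (Regular {n} Δ G × SlExceeds G n ((fromℕ Δ -ᴿ fromℕ 4 -ᴿ ε) *ᴿ fromℚ (+ 1 / 4))))
large-slope-parameter Δ d refl d<4 Δ-4≡ ε 0<ε =
  let l , a<p/q = exponent-below Δ d ε Δ-4≡ 0<ε in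
  Growth.threshold (suc d) (suc l) , λ n n> 2∣Δn →
  let p = l + d * suc l
      K , K^Q≤ , <sucK^Q = integer-root (4 * suc l) (n ^ p)
      1≤n^p = ℕₚ.m^n>0 n {{ℕ.>-nonZero (ℕₚ.≤-<-trans z≤n n>)}} p
      -- K = 0 would mean n^p < 1.
      1≤K = ℕₚ.≮⇒≥ λ K<1 → ℕₚ.<⇒≱ <sucK^Q (ℕₚ.≤-trans
        (ℕₚ.≤-trans (ℕₚ.^-monoˡ-≤ (4 * suc l) K<1) (ℕₚ.≤-reflexive (ℕₚ.^-zeroˡ (4 * suc l)))) 1≤n^p)
      G , regular , defined , above = regular-unrealisable d l n K d<4 n> 2∣Δn 1≤K K^Q≤
  in G , regular , record
    { defined = defined
    -- The exponent is p / suc q with suc q = 4 * suc l. Every realising k is at least suc K, and K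
    -- was chosen so that n^p < suc K ^ suc q.
    ; above = λ k (realisable , _) → p , l + 3 * suc l , a<p/q
        , ℕₚ.<-≤-trans <sucK^Q (ℕₚ.^-monoˡ-≤ (4 * suc l) (above k realisable))
    }

theorem5 : ∀ (Δ : ℕ) → Δ ∈ 5 ∷ 6 ∷ 7 ∷ 8 ∷ [] →
    ∀ (ε : ℝ) → fromℕ 0 <ᴿ ε → ε <ᴿ fromℕ Δ -ᴿ fromℕ 4 →
    ∃[ n₀ ] (∀ (n : ℕ) → n > n₀ → 2 ∣ Δ * n →
    ∃[ G ] (Regular {n} Δ G ×
    SlExceeds G n ((fromℕ Δ -ᴿ fromℕ 4 -ᴿ ε) *ᴿ fromℚ (+ 1 / 4))))
theorem5 Δ (here refl) ε 0<ε _ =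
  large-slope-parameter Δ 0 refl (s≤s z≤n) refl ε 0<ε
theorem5 Δ (there (here refl)) ε 0<ε _ =
  large-slope-parameter Δ 1 refl (s≤s (s≤s z≤n)) refl ε 0<ε
theorem5 Δ (there (there (here refl))) ε 0<ε _ =
  large-slope-parameter Δ 2 refl (s≤s (s≤s (s≤s z≤n))) refl ε 0<ε
theorem5 Δ (there (there (there (here refl)))) ε 0<ε _ =
  large-slope-parameter Δ 3 refl ℕₚ.≤-refl refl ε 0<ε
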